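{- Let $r \ge 2$ be an integer. Then for all integers $k\ge1$ and $n\ge rk$ and every partition $\mathcal{P} = \{P_1, \dots, P_\ell\}$ of $[n]$ with $|P_i| \le b(r)$ for all $i \in [\ell]$, we have $$\chi(\mathrm{KG}^r(n, k; \mathcal{P})) = \left\lceil \frac{n-r(k-1)}{r-1} \right\rceil.$$
   Context: For an integer $r\ge2$ with prime factorization $r=2^{\alpha_0}p_1^{\alpha_1}\cdots p_t^{\alpha_t}$ ($p_i$ pairwise distinct odd primes, $\alpha_i\ge0$), $b(r)=2^{\alpha_0}(p_1-1)^{\alpha_1}\cdots(p_t-1)^{\alpha_t}$. For a hypergraph $H$ (a set of hyperedges, each a multisubset of the vertex set), an $m$-coloring is a map from the vertices to $[m]$ such that no hyperedge is monochromatic; $\chi(H)$ is the least such $m$. For a partition $\mathcal{P}=\{P_1,\dots,P_\ell\}$ of $[n]$, $\mathrm{KG}^r(n,k;\mathcal{P})$ is the $r$-uniform hypergraph whose vertices are the $k$-element subsets $\sigma\subseteq[n]$ with $|\sigma\cap P_i|\le 1$ for all $i$, and whose hyperedges are the collections of $r$ such sets that are pairwise disjoint. -}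

module Defs where

open import Data.Nat using (ℕ; zero; suc; _+_; _*_; _∸_; _≤_; _≟_; NonZero)
open import Data.Nat.DivMod using (_/_)
open import Data.Nat.Primality.Factorisation using (factorise; factors)
open import Data.List using (List; map)
open import Data.Nat.ListAction using (product)
open import Data.Fin using (Fin)
open import Data.Fin.Subset using (Subset; _∈_; ∣_∣; _∩_; Empty)
open import Data.Product using (Σ; ∃; _×_; proj₁)
open import Relation.Nullary using (¬_; yes; no)
open import Relation.Binary.PropositionalEquality using (_≡_; _≢_)

bFactor : ℕ → ℕ
bFactor p with p ≟ 2
... | yes _ = 2
... | no  _ = p ∸ 1

-- b(r) = 2^α₀ (p₁-1)^α₁ ⋯ (p_t-1)^α_t, computed from the prime
-- factorisation of r (list of prime factors with multiplicity)
-- (only r ≥ 1 is meaningful; b 0 is set to 0 and never used)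
b : ℕ → ℕ
b zero    = 0
b (suc r) = product (map bFactor (factors (factorise (suc r))))

-- ⌈ a / d ⌉ for d ≥ 1 (the value for d = 0 is irrelevant, set to 0)
ceilDiv : ℕ → ℕ → ℕ
ceilDiv a zero    = 0
ceilDiv a (suc d) = (a + d) / suc d

-- A partition 𝒫 = {P₁,…,P_ℓ} of [n], given by the block-index map
-- blk : [n] → [ℓ] (P_i = blk⁻¹(i)); blocks are nonempty, i.e. blk is surjective.
record Partition (n : ℕ) : Set where
  field
    ℓ   : ℕ
    blk : Fin n → Fin ℓ
    nonempty : ∀ (i : Fin ℓ) → ∃ λ x → blk x ≡ i

open Partition public

block : ∀ {n} (P : Partition n) → Fin (ℓ P) → Subset n
block {n} P i = Data.Vec.tabulate λ x → isBlk (blk P x)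
  where
  open import Data.Vec
  open import Data.Bool using (Bool; true; false)
  open import Data.Fin using () renaming (_≟_ to _≟ᶠ_)
  isBlk : Fin (ℓ P) → Bool
  isBlk j with j ≟ᶠ i
  ... | yes _ = true
  ... | no  _ = false

IsVertex : ∀ {n} (k : ℕ) (P : Partition n) → Subset n → Set
IsVertex k P σ = (∣ σ ∣ ≡ k) × (∀ i → ∣ σ ∩ block P i ∣ ≤ 1)

-- hyperedges of KG^r(n,k;𝒫): r vertices that are pairwise disjoint
-- (disjoint nonempty sets are automatically distinct)
IsHyperedge : ∀ {n} (r k : ℕ) (P : Partition n) → (Fin r → Subset n) → Set
IsHyperedge r k P σ =
  (∀ i → IsVertex k P (σ i)) × (∀ i j → i ≢ j → Empty (σ i ∩ σ j))

IsColoring : ∀ {n} (r k : ℕ) (P : Partition n) (m : ℕ) →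
             ((σ : Subset n) → IsVertex k P σ → Fin m) → Set
IsColoring {n} r k P m c =
  ∀ (σ : Fin r → Subset n) (h : IsHyperedge r k P σ) →
    ¬ (∀ i j → c (σ i) (proj₁ h i) ≡ c (σ j) (proj₁ h j))

Colorable : ∀ {n} (r k : ℕ) (P : Partition n) (m : ℕ) → Set
Colorable {n} r k P m =
  Σ ((σ : Subset n) → IsVertex k P σ → Fin m) (IsColoring r k P m)

ChromaticNumberIs : ∀ {n} (r k : ℕ) (P : Partition n) (N : ℕ) → Set
ChromaticNumberIs r k P N =
  Colorable r k P N × (∀ m → Colorable r k P m → N ≤ m)

{-# OPTIONS --safe #-}

-- The lower bound holds for all blocks of size at most r ≥ b(r), and it is multiplicative in r:
-- from colourings for r₁ one colours larger sets A by a colour c such that A contains r₁ disjoint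
-- admissible sets of colour c, and applies the bound for r₂ after cutting every block into r₁
-- pieces of size at most r₂.  So let r = p be prime and suppose a colouring with m colours has no
-- monochromatic hyperedge, where p(k − 1) + m(p − 1) < n.
--
-- For a nonzero X ∈ (ℤ/p ∪ {0})ⁿ let T_B(X) be the set of signs that X takes on the block B, and
-- U_c(X) the set of signs i such that X⁻¹(i) contains an admissible set of colour c; the latter is
-- never all of ℤ/p.  Put ρ(X) = Σ_B |T_B(X)| if this is at most p(k − 1), and
-- ρ(X) = p(k − 1) + Σ_c |U_c(X)| otherwise.  This rank is monotone and smaller than n, and since p
-- is prime there is an equivariant sign λ(X) ∈ ℤ/p that is constant along steps X ≤ Y with
-- ρ(X) = ρ(Y).  A ℤ/p-Tucker lemma forbids this: λ pulls the generator of Hⁿ⁻¹(ℤ/p; 𝔽_p),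
-- represented by a normalised bar cocycle w, back to the complete flags of sign vectors.  Every
-- complete flag repeats a value of ρ, so w vanishes on all of them; yet its value on the
-- fundamental chain of the n-fold join of ℤ/p is 1 modulo p, by Stokes' formula and induction on n.
module Submission where

open import Defs
open import Data.Nat as ℕ using (ℕ; zero; suc; z≤n; s≤s)
import Data.Nat.Properties as ℕₚ
open import Data.Nat.DivMod using (_mod_; m≡m%n+[m/n]*n; m%n<n; m<n*o⇒m/o<n)
open import Data.Nat.Divisibility using (_∣_; ∣⇒≤; >⇒∤)
open import Data.Nat.ListAction using (product)
open import Data.Nat.Primality using (Prime; ¬prime[0]; ¬prime[1]; euclidsLemma)
open import Data.Nat.Primality.Factorisation using (factorise; factors; module PrimeFactorisation)
open import Data.Nat.Tactic.RingSolver using () renaming (solve-∀ to ℕ-solve-∀)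
open import Data.Integer as Int using (ℤ; +_; 0ℤ; 1ℤ; -1ℤ)
import Data.Integer.Properties as ℤₚ
open import Data.Integer.Divisibility.Signed using (divides; ∣⇒∣ᵤ)
open import Data.Integer.Tactic.RingSolver using (solve-∀)
open import Algebra.Properties.AbelianGroup ℤₚ.+-0-abelianGroup using (∙-cancelʳ)
open import Algebra.Properties.CommutativeMonoid.Sum ℕₚ.+-0-commutativeMonoid using (sum; sum-cong-≗; sum-permute; ∑-comm)
open import Algebra.Properties.CommutativeMonoid.Sum ℤₚ.+-0-commutativeMonoid using () renaming (sum to sumᶻ; sum-cong-≗ to sumᶻ-cong; sum-permute to sumᶻ-permute)
open import Data.Bool using (Bool; true; false; _∧_) renaming (_≟_ to _≟ᵇ_)
open import Data.Fin using (Fin; zero; suc; toℕ; fromℕ; fromℕ<; inject₁; inject≤; punchOut; combine; remQuot; _≟_)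
open import Data.Fin.Permutation using (Permutation′; permutation)
open import Data.Fin.Properties using (any?; all?; suc-injective; punchOut-injective; injective⇒≤; pigeonhole)
import Data.Fin.Properties as Finₚ
open import Data.Fin.Subset using (Subset; _∈_; _∩_; ∣_∣; Empty)
open import Data.Fin.Subset.Properties using (_∈?_; anySubset?; x∈p∩q⁻; x∈p∩q⁺)
open import Data.List as List using ()
open import Data.List.Relation.Unary.All as All using (All)
open import Data.Vec using (Vec; []; _∷_; lookup; map; replicate; tabulate)
open import Data.Vec.Properties using (lookup∘tabulate; lookup-map; lookup⇒[]=; []=⇒lookup)
open import Data.Maybe as Maybe using (Maybe; just; nothing; fromMaybe)
import Data.Maybe.Properties as Maybeₚ
open import Data.Product using (∃; ∃₂; _×_; _,_; proj₁; proj₂)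
open import Data.Sum using (_⊎_; inj₁; inj₂; [_,_]′)
open import Data.Unit using (⊤; tt)
open import Data.Empty using (⊥)
open import Function using (_∘_)
open import Function.Bundles using (mk⇔)
open import Relation.Nullary using (¬_; Dec; yes; no; does; contradiction)
open import Relation.Nullary.Decidable using (_×-dec_; _→-dec_; map′; dec-true; does-⇔; decidable-stable)
open import Relation.Binary.PropositionalEquality using (_≡_; _≢_; refl; sym; trans; cong; cong₂; subst; module ≡-Reasoning)

-- The cyclic group ℤ/p with integral carries.

module Cyclic (q : ℕ) where
  open Int using (_+_; _-_; _*_)

  p : ℕ
  p = suc q

  Z : Set
  Z = Fin p

  rot : Z → Z
  rot g with toℕ g ℕ.<? q
  ... | yes g<q = suc (fromℕ< g<q)
  ... | no  _   = zero

  -- The wrap-around term of `rot`. It is an integer so that congruences modulo p become exact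
  -- identities with an explicit multiple of p.
  top : Z → ℤ
  top g with toℕ g ℕ.<? q
  ... | yes _ = 0ℤ
  ... | no  _ = 1ℤ

  ⟦_⟧ : Z → ℤ
  ⟦ g ⟧ = + toℕ g

  ⟦rot⟧ : ∀ g → ⟦ rot g ⟧ ≡ ⟦ g ⟧ + (1ℤ - + p * top g)
  ⟦rot⟧ g with toℕ g ℕ.<? q
  ... | yes g<q = trans (cong (λ t → + suc t) (Finₚ.toℕ-fromℕ< g<q)) (trans (ℤₚ.+-comm 1ℤ (+ toℕ g)) (lem (+ toℕ g) (+ p)))
    where
    lem : ∀ a b → a + 1ℤ ≡ a + (1ℤ - b * 0ℤ)
    lem = solve-∀
  ... | no g≮q = trans (lem (+ q)) (cong (λ t → + t + (1ℤ - + p * 1ℤ)) (sym g≡q))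
    where
    g≡q : toℕ g ≡ q
    g≡q = ℕₚ.≤-antisym (ℕ.s≤s⁻¹ (Finₚ.toℕ<n g)) (ℕₚ.≮⇒≥ g≮q)
    lem : ∀ a → 0ℤ ≡ a + (1ℤ - (1ℤ + a) * 1ℤ)
    lem = solve-∀

  carry : Z → Z → ℤ
  carry g h with toℕ h ℕ.<? toℕ g
  ... | yes _ = 1ℤ
  ... | no  _ = 0ℤ

  -- The representative in {0, …, p − 1} of h − g.
  diff : Z → Z → ℤ
  diff g h = (⟦ h ⟧ - ⟦ g ⟧) + + p * carry g h

  carry-refl : ∀ g → carry g g ≡ 0ℤ
  carry-refl g with toℕ g ℕ.<? toℕ g
  ... | yes g<g = contradiction g<g (ℕₚ.<-irrefl refl)
  ... | no  _   = refl

  diff-refl : ∀ g → diff g g ≡ 0ℤ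
  diff-refl g rewrite carry-refl g = lem ⟦ g ⟧ (+ p)
    where
    lem : ∀ a b → (a - a) + b * 0ℤ ≡ 0ℤ
    lem = solve-∀

  carry-yes : ∀ {g h} → toℕ h ℕ.< toℕ g → carry g h ≡ 1ℤ
  carry-yes {g} {h} lt with toℕ h ℕ.<? toℕ g
  ... | yes _  = refl
  ... | no ¬lt = contradiction lt ¬lt

  carry-no : ∀ {g h} → ¬ (toℕ h ℕ.< toℕ g) → carry g h ≡ 0ℤ
  carry-no {g} {h} ¬lt with toℕ h ℕ.<? toℕ g
  ... | yes lt = contradiction lt ¬lt
  ... | no  _  = refl

  private
    <-equiv⇒carry : ∀ {g h g′ h′} → (toℕ h′ ℕ.< toℕ g′ → toℕ h ℕ.< toℕ g) →
                    (toℕ h ℕ.< toℕ g → toℕ h′ ℕ.< toℕ g′) → carry g′ h′ ≡ carry g h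
    <-equiv⇒carry {g} {h} to from with toℕ h ℕ.<? toℕ g
    ... | yes lt = carry-yes (from lt)
    ... | no ¬lt = carry-no (¬lt ∘ to)

  -- Wrapping one of the two arguments reverses their order. The change of `carry` is exactly what
  -- compensates the change of `⟦_⟧`, so that `diff` becomes invariant.
  carry-rot : ∀ g h → carry (rot g) (rot h) ≡ carry g h + (top h - top g)
  carry-rot g h with toℕ g ℕ.<? q | toℕ h ℕ.<? q
  ... | yes g<q | yes h<q = trans
        (<-equiv⇒carry {g} {h} {suc (fromℕ< g<q)} {suc (fromℕ< h<q)}
          (λ { (s≤s lt) → subst₂′ (Finₚ.toℕ-fromℕ< h<q) (Finₚ.toℕ-fromℕ< g<q) lt })
          (λ lt → s≤s (subst₂′ (sym (Finₚ.toℕ-fromℕ< h<q)) (sym (Finₚ.toℕ-fromℕ< g<q)) lt)))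
        (sym (ℤₚ.+-identityʳ _))
    where
    subst₂′ : ∀ {a b c d} → a ≡ b → c ≡ d → a ℕ.< c → b ℕ.< d
    subst₂′ refl refl lt = lt
  ... | yes g<q | no h≮q =
        sym (cong (_+ (1ℤ - 0ℤ)) (carry-no (λ h<g → h≮q (ℕₚ.<-trans h<g g<q))))
  ... | no g≮q | yes h<q =
        sym (cong (_+ (0ℤ - 1ℤ)) (carry-yes (ℕₚ.<-≤-trans h<q (ℕₚ.≮⇒≥ g≮q))))
  ... | no g≮q | no h≮q =
        sym (cong (_+ (1ℤ - 1ℤ)) (carry-no (λ h<g → h≮q (ℕₚ.<-≤-trans h<g (ℕ.s≤s⁻¹ (Finₚ.toℕ<n g))))))

  diff-rot : ∀ g h → diff (rot g) (rot h) ≡ diff g h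
  diff-rot g h rewrite carry-rot g h | ⟦rot⟧ g | ⟦rot⟧ h =
    lem ⟦ g ⟧ ⟦ h ⟧ (+ p) (top g) (top h) (carry g h)
    where
    lem : ∀ g h p tg th c →
          ((h + (1ℤ - p * th)) - (g + (1ℤ - p * tg))) + p * (c + (th - tg)) ≡ (h - g) + p * c
    lem = solve-∀

  rot^ : ℕ → Z → Z
  rot^ zero    g = g
  rot^ (suc i) g = rot^ i (rot g)

  rot^-+ : ∀ i j g → rot^ (i ℕ.+ j) g ≡ rot^ j (rot^ i g)
  rot^-+ zero    j g = refl
  rot^-+ (suc i) j g = rot^-+ i j (rot g)

  toℕ-rot^ : ∀ i g → toℕ g ℕ.+ i ℕ.≤ q → toℕ (rot^ i g) ≡ toℕ g ℕ.+ i
  toℕ-rot^ zero    g _  = sym (ℕₚ.+-identityʳ _)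
  toℕ-rot^ (suc i) g le with toℕ g ℕ.<? q
  ... | yes g<q = trans (toℕ-rot^ i (suc (fromℕ< g<q)) (ℕₚ.≤-trans (ℕₚ.≤-reflexive eq) le)) eq
    where
    eq : suc (toℕ (fromℕ< g<q)) ℕ.+ i ≡ toℕ g ℕ.+ suc i
    eq = trans (cong (λ t → suc t ℕ.+ i) (Finₚ.toℕ-fromℕ< g<q)) (sym (ℕₚ.+-suc (toℕ g) i))
  ... | no g≮q = contradiction
        (ℕₚ.≤-trans (s≤s (ℕₚ.m≤m+n _ i)) (ℕₚ.≤-trans (ℕₚ.≤-reflexive (sym (ℕₚ.+-suc (toℕ g) i))) le)) g≮q

  rot-top : ∀ g → toℕ g ≡ q → rot g ≡ zero
  rot-top g eq with toℕ g ℕ.<? q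
  ... | yes g<q = contradiction g<q (ℕₚ.<-irrefl eq)
  ... | no  _   = refl

  -- From g, q - g steps lead to the largest element, one more wraps to zero, and g further steps
  -- return to g.
  rot^-p : ∀ g → rot^ p g ≡ g
  rot^-p g = begin
    rot^ p g                                ≡⟨ cong (λ i → rot^ i g) p≡ ⟩
    rot^ ((q ℕ.∸ x) ℕ.+ suc x) g            ≡⟨ rot^-+ (q ℕ.∸ x) (suc x) g ⟩
    rot^ x (rot (rot^ (q ℕ.∸ x) g))         ≡⟨ cong (rot^ x) (rot-top _ atTop) ⟩
    rot^ x zero                             ≡⟨ Finₚ.toℕ-injective (toℕ-rot^ x zero x≤q) ⟩
    g                                       ∎
    where
    open ≡-Reasoning
    x : ℕ
    x = toℕ g
    x≤q : x ℕ.≤ q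
    x≤q = ℕ.s≤s⁻¹ (Finₚ.toℕ<n g)
    p≡ : p ≡ (q ℕ.∸ x) ℕ.+ suc x
    p≡ = sym (trans (ℕₚ.+-suc (q ℕ.∸ x) x) (cong suc (ℕₚ.m∸n+n≡m x≤q)))
    atTop : toℕ (rot^ (q ℕ.∸ x) g) ≡ q
    atTop = trans (toℕ-rot^ (q ℕ.∸ x) g (ℕₚ.≤-reflexive (ℕₚ.m+[n∸m]≡n x≤q))) (ℕₚ.m+[n∸m]≡n x≤q)

-- Sign vectors as simplices of the join of copies of ℤ/p, with their chains.

module SignVectors (q : ℕ) where
  open Int using (_+_; _-_; _*_)
  open Cyclic q

  V : ℕ → Set
  V = Vec (Maybe Z)

  shift : ∀ {n} → V n → V n
  shift = map (Maybe.map rot)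

  shift^ : ∀ {n} → ℕ → V n → V n
  shift^ zero    x = x
  shift^ (suc i) x = shift^ i (shift x)

  shift^-∷ : ∀ {n} i a (x : V n) → shift^ i (just a ∷ x) ≡ just (rot^ i a) ∷ shift^ i x
  shift^-∷ zero    a x = refl
  shift^-∷ (suc i) a x = shift^-∷ i (rot a) (shift x)

  shift^-nothing∷ : ∀ {n} i (x : V n) → shift^ i (nothing ∷ x) ≡ nothing ∷ shift^ i x
  shift^-nothing∷ zero    x = refl
  shift^-nothing∷ (suc i) x = shift^-nothing∷ i (shift x)

  shift^-p : ∀ {n} (x : V n) → shift^ p x ≡ x
  shift^-p x = go x
    where
    shift^-[] : ∀ i → shift^ i [] ≡ []
    shift^-[] zero    = refl
    shift^-[] (suc i) = shift^-[] i
    go : ∀ {n} (x : V n) → shift^ p x ≡ x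
    go []            = shift^-[] p
    go (nothing ∷ x) = trans (shift^-nothing∷ p x) (cong (nothing ∷_) (go x))
    go (just a ∷ x)  = trans (shift^-∷ p a x) (cong₂ (λ b y → just b ∷ y) (rot^-p a) (go x))

  infix 4 _≼_
  _≼_ : ∀ {n} → V n → V n → Set
  Y ≼ X = ∀ i {a} → lookup Y i ≡ just a → lookup X i ≡ just a

  ∷-≼ : ∀ {n} a {x y : V n} → y ≼ x → (a ∷ y) ≼ (a ∷ x)
  ∷-≼ a y≼x zero    eq = eq
  ∷-≼ a y≼x (suc i) eq = y≼x i eq

  nothing∷-≼ : ∀ {n} a (x : V n) → (nothing ∷ x) ≼ (a ∷ x)
  nothing∷-≼ a x (suc i) eq = eq

  Nonzero : ∀ {n} → V n → Set
  Nonzero X = ∃₂ λ i a → lookup X i ≡ just a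

  nonzero? : ∀ {n} (X : V n) → Nonzero X ⊎ X ≡ replicate n nothing
  nonzero? []           = inj₂ refl
  nonzero? (just a ∷ x) = inj₁ (zero , a , refl)
  nonzero? (nothing ∷ x) with nonzero? x
  ... | inj₁ (i , a , eq) = inj₁ (suc i , a , eq)
  ... | inj₂ eq           = inj₂ (cong (nothing ∷_) eq)

  -- Chains are represented by the linear functionals they induce on cochains:
  -- ∂ X G is the value of G on the boundary of the simplex X, whose vertices are
  -- the nonzero coordinates of X (the empty face included).
  ∂ : ∀ {n} → V n → (V n → ℤ) → ℤ
  ∂ []            G = 0ℤ
  ∂ (nothing ∷ x) G = ∂ x (λ y → G (nothing ∷ y))
  ∂ (just a ∷ x)  G = G (nothing ∷ x) - ∂ x (λ y → G (just a ∷ y))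

  -- The boundary evaluates only on faces of X. This relative form makes Y ≼ X available when a rank
  -- is compared along a flag.
  ∂-cong≼ : ∀ {n} (X : V n) {G H : V n → ℤ} → (∀ Y → Y ≼ X → G Y ≡ H Y) → ∂ X G ≡ ∂ X H
  ∂-cong≼ []            eq = refl
  ∂-cong≼ (nothing ∷ x) eq = ∂-cong≼ x (λ y y≼x → eq _ (∷-≼ nothing y≼x))
  ∂-cong≼ (just a ∷ x)  eq =
    cong₂ _-_ (eq _ (nothing∷-≼ (just a) x)) (∂-cong≼ x (λ y y≼x → eq _ (∷-≼ (just a) y≼x)))

  ∂-cong : ∀ {n} (X : V n) {G H : V n → ℤ} → (∀ Y → G Y ≡ H Y) → ∂ X G ≡ ∂ X H
  ∂-cong X eq = ∂-cong≼ X (λ Y _ → eq Y)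

  ∂-lin : ∀ {n} (X : V n) c (G H : V n → ℤ) → ∂ X (λ Y → G Y + c * H Y) ≡ ∂ X G + c * ∂ X H
  ∂-lin []            c G H = sym (trans (ℤₚ.+-identityˡ _) (ℤₚ.*-zeroʳ c))
  ∂-lin (nothing ∷ x) c G H = ∂-lin x c _ _
  ∂-lin (just a ∷ x)  c G H rewrite ∂-lin x c (G ∘ (just a ∷_)) (H ∘ (just a ∷_)) =
    lem (G (nothing ∷ x)) (H (nothing ∷ x)) (∂ x (G ∘ (just a ∷_))) (∂ x (H ∘ (just a ∷_))) c
    where
    lem : ∀ g h dg dh c → (g + c * h) - (dg + c * dh) ≡ (g - dg) + c * (h - dh)
    lem = solve-∀

  private
    -≡+-1* : ∀ a b → a - b ≡ a + -1ℤ * b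
    -≡+-1* = solve-∀

  ∂-sub : ∀ {n} (X : V n) (G H : V n → ℤ) → ∂ X (λ Y → G Y - H Y) ≡ ∂ X G - ∂ X H
  ∂-sub X G H = trans (∂-cong X (λ Y → -≡+-1* (G Y) (H Y)))
    (trans (∂-lin X -1ℤ G H) (sym (-≡+-1* (∂ X G) (∂ X H))))

  ∂-0 : ∀ {n} (X : V n) → ∂ X (λ _ → 0ℤ) ≡ 0ℤ
  ∂-0 X = trans (∂-sub X (λ _ → 0ℤ) (λ _ → 0ℤ)) (ℤₚ.+-inverseʳ (∂ X (λ _ → 0ℤ)))

  ∂-replicate-nothing : ∀ n (G : V n → ℤ) → ∂ (replicate n nothing) G ≡ 0ℤ
  ∂-replicate-nothing zero    G = refl
  ∂-replicate-nothing (suc n) G = ∂-replicate-nothing n _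

  ∂∂ : ∀ {n} (X : V n) (G : V n → ℤ) → ∂ X (λ Y → ∂ Y G) ≡ 0ℤ
  ∂∂ []            G = refl
  ∂∂ (nothing ∷ x) G = ∂∂ x _
  ∂∂ (just a ∷ x)  G
    rewrite ∂-sub x (λ y → G (nothing ∷ y)) (λ y → ∂ y (λ z → G (just a ∷ z)))
          | ∂∂ x (λ z → G (just a ∷ z)) = lem (∂ x (λ y → G (nothing ∷ y)))
    where
    lem : ∀ a → a - (a - 0ℤ) ≡ 0ℤ
    lem = solve-∀

  ∂-shift : ∀ {n} (X : V n) (G : V n → ℤ) → ∂ (shift X) G ≡ ∂ X (G ∘ shift)
  ∂-shift []            G = refl
  ∂-shift (nothing ∷ x) G = ∂-shift x _
  ∂-shift (just a ∷ x)  G = cong (λ t → G (nothing ∷ shift x) - t) (∂-shift x (λ y → G (just (rot a) ∷ y)))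

  -- Action of 1 + s + ⋯ + sⁱ⁻¹ on cochains, s being the shift; for i = p this is the norm element
  -- of the group ring.
  orb : ∀ {n} → ℕ → (V n → ℤ) → V n → ℤ
  orb zero    G x = 0ℤ
  orb (suc i) G x = G x + orb i G (shift x)

  orb-cong : ∀ {n} i {G H : V n → ℤ} → (∀ y → G y ≡ H y) → ∀ x → orb i G x ≡ orb i H x
  orb-cong zero    eq x = refl
  orb-cong (suc i) eq x = cong₂ _+_ (eq x) (orb-cong i eq (shift x))

  orb-sub : ∀ {n} i (G H : V n → ℤ) x → orb i (λ y → G y - H y) x ≡ orb i G x - orb i H x
  orb-sub zero    G H x = refl
  orb-sub (suc i) G H x rewrite orb-sub i G H (shift x) = lem (G x) (H x) (orb i G (shift x)) (orb i H (shift x))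
    where
    lem : ∀ a b c d → (a - b) + (c - d) ≡ (a + c) - (b + d)
    lem = solve-∀

  orb-∘shift : ∀ {n} i (G : V n → ℤ) x → orb i (G ∘ shift) x ≡ orb i G (shift x)
  orb-∘shift zero    G x = refl
  orb-∘shift (suc i) G x = cong (λ t → G (shift x) + t) (orb-∘shift i G (shift x))

  orb-∂ : ∀ {n} i (G : V n → ℤ) x → orb i (λ y → ∂ y G) x ≡ ∂ x (orb i G)
  orb-∂ zero    G x = sym (∂-0 x)
  orb-∂ (suc i) G x = begin
    ∂ x G + orb i (λ y → ∂ y G) (shift x)    ≡⟨ cong (λ t → ∂ x G + t) (orb-∂ i G (shift x)) ⟩
    ∂ x G + ∂ (shift x) (orb i G)            ≡⟨ cong (λ t → ∂ x G + t) (∂-shift x (orb i G)) ⟩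
    ∂ x G + ∂ x (orb i G ∘ shift)            ≡⟨ cong (λ t → ∂ x G + t) (sym (ℤₚ.*-identityˡ (∂ x (orb i G ∘ shift)))) ⟩
    ∂ x G + 1ℤ * ∂ x (orb i G ∘ shift)       ≡⟨ sym (∂-lin x 1ℤ G (orb i G ∘ shift)) ⟩
    ∂ x (λ y → G y + 1ℤ * orb i G (shift y)) ≡⟨ ∂-cong x (λ y → cong (λ t → G y + t) (ℤₚ.*-identityˡ (orb i G (shift y)))) ⟩
    ∂ x (orb (suc i) G)                      ∎
    where open ≡-Reasoning

  -- The identity (s - 1)(1 + s + ⋯ + sⁱ⁻¹) = sⁱ - 1, arranged without subtraction. For i = p the
  -- right-hand side of it vanishes, so the norm absorbs s.
  orb-telescope : ∀ {n} i (G : V n → ℤ) x → orb i G (shift x) + G x ≡ orb i G x + G (shift^ i x)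
  orb-telescope zero    G x = refl
  orb-telescope (suc i) G x = begin
    (G (shift x) + orb i G (shift (shift x))) + G x   ≡⟨ lem₁ (G (shift x)) (orb i G (shift (shift x))) (G x) ⟩
    G x + (orb i G (shift (shift x)) + G (shift x))   ≡⟨ cong (λ t → G x + t) (orb-telescope i G (shift x)) ⟩
    G x + (orb i G (shift x) + G (shift^ i (shift x))) ≡⟨ sym (ℤₚ.+-assoc (G x) _ _) ⟩
    (G x + orb i G (shift x)) + G (shift^ i (shift x)) ∎
    where
    open ≡-Reasoning
    lem₁ : ∀ a b c → (a + b) + c ≡ c + (b + a)
    lem₁ = solve-∀

  orb-p-shift : ∀ {n} (G : V n → ℤ) x → orb p G (shift x) ≡ orb p G x
  orb-p-shift G x = ∙-cancelʳ (G x) (orb p G (shift x)) (orb p G x)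
    (trans (orb-telescope p G x) (cong (λ y → orb p G x + G y) (shift^-p x)))

  orb-invariant : ∀ {n} i (G : V n → ℤ) → (∀ y → G (shift y) ≡ G y) → ∀ x → orb i G x ≡ + i * G x
  orb-invariant zero    G inv x = sym (ℤₚ.*-zeroˡ (G x))
  orb-invariant (suc i) G inv x = begin
    G x + orb i G (shift x) ≡⟨ cong (λ t → G x + t) (orb-invariant i G inv (shift x)) ⟩
    G x + + i * G (shift x) ≡⟨ cong (λ t → G x + + i * t) (inv x) ⟩
    G x + + i * G x         ≡⟨ lem (+ i) (G x) ⟩
    (1ℤ + + i) * G x        ∎
    where
    open ≡-Reasoning
    lem : ∀ i g → g + i * g ≡ (1ℤ + i) * g
    lem = solve-∀

  -- Numbers of coordinates: the superscripts ᵉ and ᵒ below refer to their parity, while the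
  -- dimension of the chain is one less. In this form `odd (suc j)` reduces to two more than
  -- `odd j`, so vectors can be extended without transport.
  even odd : ℕ → ℕ
  even zero    = 0
  even (suc j) = suc (suc (even j))
  odd j = suc (even j)

  -- The chains c₀, c₁, c₂, … with ∂c₂ⱼ₊₁ = (s − 1)c₂ⱼ and ∂c₂ⱼ₊₂ = (1 + s + ⋯ + sᵖ⁻¹)c₂ⱼ₊₁,
  -- each obtained by coning with a vertex in a new coordinate;
  -- Φᵒ j and Φᵉ j stand for c₂ⱼ and c₂ⱼ₊₁.
  mutual
    Φᵒ : ∀ j → (V (odd j) → ℤ) → ℤ
    Φᵒ zero    G = G (just zero ∷ [])
    Φᵒ (suc j) G = Φᵉ j (orb p (λ y → G (just zero ∷ y)))

    Φᵉ : ∀ j → (V (suc (odd j)) → ℤ) → ℤ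
    Φᵉ j G = Φᵒ j (λ x → G (just zero ∷ shift x) - G (just zero ∷ x))

  mutual
    Φᵒ-cong : ∀ j {G H} → (∀ x → G x ≡ H x) → Φᵒ j G ≡ Φᵒ j H
    Φᵒ-cong zero    eq = eq _
    Φᵒ-cong (suc j) eq = Φᵉ-cong j (orb-cong p (λ y → eq _))

    Φᵉ-cong : ∀ j {G H} → (∀ x → G x ≡ H x) → Φᵉ j G ≡ Φᵉ j H
    Φᵉ-cong j eq = Φᵒ-cong j (λ x → cong₂ _-_ (eq _) (eq _))

  orb-lin : ∀ {n} i c (G H : V n → ℤ) x → orb i (λ y → G y + c * H y) x ≡ orb i G x + c * orb i H x
  orb-lin zero    c G H x = sym (trans (ℤₚ.+-identityˡ _) (ℤₚ.*-zeroʳ c))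
  orb-lin (suc i) c G H x rewrite orb-lin i c G H (shift x) =
    lem (G x) (H x) (orb i G (shift x)) (orb i H (shift x)) c
    where
    lem : ∀ g h og oh c → (g + c * h) + (og + c * oh) ≡ (g + og) + c * (h + oh)
    lem = solve-∀

  mutual
    Φᵒ-lin : ∀ j c G H → Φᵒ j (λ x → G x + c * H x) ≡ Φᵒ j G + c * Φᵒ j H
    Φᵒ-lin zero    c G H = refl
    Φᵒ-lin (suc j) c G H = trans (Φᵉ-cong j (orb-lin p c G₀ H₀)) (Φᵉ-lin j c (orb p G₀) (orb p H₀))
      where
      G₀ H₀ : V (suc (odd j)) → ℤ
      G₀ y = G (just zero ∷ y)
      H₀ y = H (just zero ∷ y)

    Φᵉ-lin : ∀ j c G H → Φᵉ j (λ x → G x + c * H x) ≡ Φᵉ j G + c * Φᵉ j H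
    Φᵉ-lin j c G H = trans
      (Φᵒ-cong j (λ x → lem (G (just zero ∷ shift x)) (H (just zero ∷ shift x)) (G (just zero ∷ x)) (H (just zero ∷ x)) c))
      (Φᵒ-lin j c (λ x → G (just zero ∷ shift x) - G (just zero ∷ x)) (λ x → H (just zero ∷ shift x) - H (just zero ∷ x)))
      where
      lem : ∀ g h g′ h′ c → (g + c * h) - (g′ + c * h′) ≡ (g - g′) + c * (h - h′)
      lem = solve-∀

  Φᵒ-0 : ∀ j → Φᵒ j (λ _ → 0ℤ) ≡ 0ℤ
  Φᵒ-0 j = trans (Φᵒ-lin j -1ℤ (λ _ → 0ℤ) (λ _ → 0ℤ)) (lem (Φᵒ j (λ _ → 0ℤ)))
    where
    lem : ∀ a → a + -1ℤ * a ≡ 0ℤ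
    lem = solve-∀

  Φᵉ-0 : ∀ j → Φᵉ j (λ _ → 0ℤ) ≡ 0ℤ
  Φᵉ-0 j = Φᵒ-0 j

  mutual
    -- The faces opposite to the cone vertex form (s - 1)c₂ⱼ; the remaining faces cone off the
    -- boundary of (s - 1)c₂ⱼ, which is zero.
    Φᵉ-∂ : ∀ j (G : V (suc (odd j)) → ℤ) →
           Φᵉ j (λ X → ∂ X G) ≡ Φᵒ j (λ x → G (nothing ∷ shift x) - G (nothing ∷ x))
    Φᵉ-∂ j G = begin
      Φᵉ j (λ X → ∂ X G)
        ≡⟨ Φᵒ-cong j step ⟩
      Φᵒ j (λ x → (G (nothing ∷ shift x) - G (nothing ∷ x)) + -1ℤ * ∂ x H)
        ≡⟨ Φᵒ-lin j -1ℤ _ _ ⟩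
      Φᵒ j (λ x → G (nothing ∷ shift x) - G (nothing ∷ x)) + -1ℤ * Φᵒ j (λ x → ∂ x H)
        ≡⟨ cong (λ t → Φᵒ j (λ x → G (nothing ∷ shift x) - G (nothing ∷ x)) + -1ℤ * t) (Φᵒ-∂-coboundary j G₀) ⟩
      Φᵒ j (λ x → G (nothing ∷ shift x) - G (nothing ∷ x)) + -1ℤ * 0ℤ
        ≡⟨ ℤₚ.+-identityʳ _ ⟩
      Φᵒ j (λ x → G (nothing ∷ shift x) - G (nothing ∷ x)) ∎
      where
      open ≡-Reasoning
      G₀ H : V (odd j) → ℤ
      G₀ y = G (just zero ∷ y)
      H y = G₀ (shift y) - G₀ y
      lem : ∀ a b c d → (a - b) - (c - d) ≡ (a - c) + -1ℤ * (b - d)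
      lem = solve-∀
      step : ∀ x → ∂ (just zero ∷ shift x) G - ∂ (just zero ∷ x) G ≡
                   (G (nothing ∷ shift x) - G (nothing ∷ x)) + -1ℤ * ∂ x H
      step x = trans (lem (G (nothing ∷ shift x)) (∂ (shift x) G₀) (G (nothing ∷ x)) (∂ x G₀))
        (cong (λ t → (G (nothing ∷ shift x) - G (nothing ∷ x)) + -1ℤ * t)
          (trans (cong (_- ∂ x G₀) (∂-shift x G₀)) (sym (∂-sub x (G₀ ∘ shift) G₀))))

    -- The chain (s - 1)c₂ⱼ is a cycle: for j = 0 both points have the same empty face, and
    -- afterwards ∂c₂ⱼ is a norm, which s - 1 kills.
    Φᵒ-∂-coboundary : ∀ j (G : V (odd j) → ℤ) → Φᵒ j (λ x → ∂ x (λ y → G (shift y) - G y)) ≡ 0ℤ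
    Φᵒ-∂-coboundary zero    G = lem (G (nothing ∷ []))
      where
      lem : ∀ a → (a - a) - 0ℤ ≡ 0ℤ
      lem = solve-∀
    Φᵒ-∂-coboundary (suc j) G = begin
      Φᵒ (suc j) (λ x → ∂ x (λ y → G (shift y) - G y)) ≡⟨ Φᵒ-∂ j (λ y → G (shift y) - G y) ⟩
      Φᵉ j (orb p (λ y → K (shift y) - K y))           ≡⟨ Φᵉ-cong j vanish ⟩
      Φᵉ j (λ _ → 0ℤ)                                  ≡⟨ Φᵉ-0 j ⟩
      0ℤ                                               ∎
      where
      open ≡-Reasoning
      K : V (suc (odd j)) → ℤ
      K y = G (nothing ∷ y)
      vanish : ∀ x → orb p (λ y → K (shift y) - K y) x ≡ 0ℤ
      vanish x = begin
        orb p (λ y → K (shift y) - K y) x   ≡⟨ orb-sub p (K ∘ shift) K x ⟩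
        orb p (K ∘ shift) x - orb p K x     ≡⟨ cong (_- orb p K x) (trans (orb-∘shift p K x) (orb-p-shift K x)) ⟩
        orb p K x - orb p K x               ≡⟨ ℤₚ.+-inverseʳ (orb p K x) ⟩
        0ℤ                                  ∎

    -- Again a cone: its base is the norm of c₂ⱼ₊₁, and this is a cycle because ∂c₂ⱼ₊₁ is a multiple
    -- of s - 1, which the norm kills.
    Φᵒ-∂ : ∀ j (G : V (odd (suc j)) → ℤ) →
           Φᵒ (suc j) (λ X → ∂ X G) ≡ Φᵉ j (orb p (λ y → G (nothing ∷ y)))
    Φᵒ-∂ j G = begin
      Φᵒ (suc j) (λ X → ∂ X G)
        ≡⟨ Φᵉ-cong j step ⟩
      Φᵉ j (λ x → orb p G∅ x + -1ℤ * ∂ x (orb p G₀))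
        ≡⟨ Φᵉ-lin j -1ℤ (orb p G∅) (λ x → ∂ x (orb p G₀)) ⟩
      Φᵉ j (orb p G∅) + -1ℤ * Φᵉ j (λ x → ∂ x (orb p G₀))
        ≡⟨ cong (λ t → Φᵉ j (orb p G∅) + -1ℤ * t) vanish ⟩
      Φᵉ j (orb p G∅) + -1ℤ * 0ℤ
        ≡⟨ ℤₚ.+-identityʳ _ ⟩
      Φᵉ j (orb p G∅) ∎
      where
      open ≡-Reasoning
      G∅ G₀ : V (suc (odd j)) → ℤ
      G∅ y = G (nothing ∷ y)
      G₀ y = G (just zero ∷ y)
      step : ∀ x → orb p (λ y → G∅ y - ∂ y G₀) x ≡ orb p G∅ x + -1ℤ * ∂ x (orb p G₀)
      step x = trans (orb-sub p G∅ (λ y → ∂ y G₀) x)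
        (trans (-≡+-1* (orb p G∅ x) (orb p (λ y → ∂ y G₀) x)) (cong (λ t → orb p G∅ x + -1ℤ * t) (orb-∂ p G₀ x)))
      vanish : Φᵉ j (λ x → ∂ x (orb p G₀)) ≡ 0ℤ
      vanish = trans (Φᵉ-∂ j (orb p G₀)) (trans (Φᵒ-cong j (λ x →
        trans (cong (_- orb p G₀ (nothing ∷ x)) (orb-p-shift G₀ (nothing ∷ x)))
              (ℤₚ.+-inverseʳ (orb p G₀ (nothing ∷ x))))) (Φᵒ-0 j))

-- Bar cochains and the ℤ/p-Tucker lemma.

module Tucker (q : ℕ) where
  open Int using (_+_; _-_; _*_; -_)
  open Cyclic q
  open SignVectors q

  -- The homogeneous bar coboundary, augmented by the empty word. Words of n letters carry cochains
  -- of degree n - 1.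
  δ : ∀ {n} → (Vec Z n → ℤ) → Vec Z (suc n) → ℤ
  δ {zero}  F (g ∷ l) = F l
  δ {suc n} F (g ∷ l) = F l - δ (λ m → F (g ∷ m)) l

  δ-cong : ∀ {n} {F G : Vec Z n → ℤ} → (∀ l → F l ≡ G l) → ∀ l → δ F l ≡ δ G l
  δ-cong {zero}  eq (g ∷ l) = eq l
  δ-cong {suc n} eq (g ∷ l) = cong₂ _-_ (eq l) (δ-cong (λ m → eq (g ∷ m)) l)

  δ-sub : ∀ {n} (F G : Vec Z n → ℤ) l → δ (λ m → F m - G m) l ≡ δ F l - δ G l
  δ-sub {zero}  F G (g ∷ l) = refl
  δ-sub {suc n} F G (g ∷ l) rewrite δ-sub (λ m → F (g ∷ m)) (λ m → G (g ∷ m)) l =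
    lem (F l) (G l) (δ (λ m → F (g ∷ m)) l) (δ (λ m → G (g ∷ m)) l)
    where
    lem : ∀ a b c d → (a - b) - (c - d) ≡ (a - c) - (b - d)
    lem = solve-∀

  δ-scale : ∀ {n} c (F : Vec Z n → ℤ) l → δ (λ m → c * F m) l ≡ c * δ F l
  δ-scale {zero}  c F (g ∷ l) = refl
  δ-scale {suc n} c F (g ∷ l) rewrite δ-scale c (λ m → F (g ∷ m)) l =
    lem c (F l) (δ (λ m → F (g ∷ m)) l)
    where
    lem : ∀ c a b → c * a - c * b ≡ c * (a - b)
    lem = solve-∀

  δδ : ∀ {n} (F : Vec Z n → ℤ) l → δ (δ F) l ≡ 0ℤ
  δδ {zero}  F (g ∷ h ∷ []) = ℤₚ.+-inverseʳ (F [])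
  δδ {suc n} F (g ∷ l) = begin
    δ F l - δ (λ m → F m - δ Fg m) l    ≡⟨ cong (λ t → δ F l - t) (δ-sub F (δ Fg) l) ⟩
    δ F l - (δ F l - δ (δ Fg) l)        ≡⟨ cong (λ t → δ F l - (δ F l - t)) (δδ Fg l) ⟩
    δ F l - (δ F l - 0ℤ)                ≡⟨ lem (δ F l) ⟩
    0ℤ                                  ∎
    where
    open ≡-Reasoning
    Fg : Vec Z n → ℤ
    Fg m = F (g ∷ m)
    lem : ∀ a → a - (a - 0ℤ) ≡ 0ℤ
    lem = solve-∀

  -- The coboundary of `carry`, invariant although `carry` is not. By `p*β` it is also the
  -- coboundary of the invariant `diff` divided by p, that is, a Bockstein.
  β : Z → Z → Z → ℤ
  β g h k = (carry h k - carry g k) + carry g h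

  p*β : ∀ g h k → + p * β g h k ≡ (diff h k - diff g k) + diff g h
  p*β g h k = lem ⟦ g ⟧ ⟦ h ⟧ ⟦ k ⟧ (+ p) (carry h k) (carry g k) (carry g h)
    where
    lem : ∀ g h k p x y z → p * ((x - y) + z) ≡
          (((k - h) + p * x) - ((k - g) + p * y)) + ((h - g) + p * z)
    lem = solve-∀

  β-rot : ∀ g h k → β (rot g) (rot h) (rot k) ≡ β g h k
  β-rot g h k rewrite carry-rot h k | carry-rot g k | carry-rot g h =
    lem (carry h k) (carry g k) (carry g h) (top g) (top h) (top k)
    where
    lem : ∀ x y z g h k → ((x + (k - h)) - (y + (k - g))) + (z + (h - g)) ≡ (x - y) + z
    lem = solve-∀

  -- Invariant cochains on the bar resolution of ℤ/p representing the generators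
  -- of its cohomology in degrees 2j (wᵒ j) and 2j + 1 (wᵉ j).
  wᵒ : ∀ j → Vec Z (odd j) → ℤ
  wᵒ zero    l               = 1ℤ
  wᵒ (suc j) (g ∷ h ∷ k ∷ l) = β g h k * wᵒ j (k ∷ l)

  wᵉ : ∀ j → Vec Z (suc (odd j)) → ℤ
  wᵉ j (g ∷ h ∷ l) = diff g h * wᵒ j (h ∷ l)

  private
    -- Closedness at g ∷ l, solved for the face that deletes g. It takes the place of a Leibniz rule
    -- for the products defining `wᵒ` and `wᵉ`.
    wᵒ-face : ∀ j → (∀ l → δ (wᵒ j) l ≡ 0ℤ) → ∀ g l → δ (λ m → wᵒ j (g ∷ m)) l ≡ wᵒ j l
    wᵒ-face j closed g l = sym (ℤₚ.i-j≡0⇒i≡j (wᵒ j l) _ (closed (g ∷ l)))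

  mutual
    -- Since p times `wᵒ (suc j)` is the coboundary of `wᵉ j`, p times its own coboundary is zero by
    -- `δδ`, and p cancels in ℤ.
    δwᵒ : ∀ j l → δ (wᵒ j) l ≡ 0ℤ
    δwᵒ zero    (g ∷ h ∷ []) = refl
    δwᵒ (suc j) l = ℤₚ.*-cancelˡ-≡ (+ p) _ 0ℤ (begin
      + p * δ (wᵒ (suc j)) l          ≡⟨ sym (δ-scale (+ p) (wᵒ (suc j)) l) ⟩
      δ (λ m → + p * wᵒ (suc j) m) l  ≡⟨ δ-cong (λ m → sym (δwᵉ j m)) l ⟩
      δ (δ (wᵉ j)) l                  ≡⟨ δδ (wᵉ j) l ⟩
      0ℤ                              ≡⟨ sym (ℤₚ.*-zeroʳ (+ p)) ⟩
      + p * 0ℤ                        ∎)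
      where open ≡-Reasoning

    -- The factor `wᵒ j` is closed, so only the coboundary of `diff` contributes, and that is p
    -- times `β`.
    δwᵉ : ∀ j l → δ (wᵉ j) l ≡ + p * wᵒ (suc j) l
    δwᵉ j (g ∷ h ∷ k ∷ l) = begin
      diff h k * w - (diff g k * w - δ (λ m → diff g h * wᵒ j (h ∷ m)) (k ∷ l))
        ≡⟨ cong (λ t → diff h k * w - (diff g k * w - t))
             (trans (δ-scale (diff g h) (λ m → wᵒ j (h ∷ m)) (k ∷ l))
                    (cong (diff g h *_) (wᵒ-face j (δwᵒ j) h (k ∷ l)))) ⟩
      diff h k * w - (diff g k * w - diff g h * w)
        ≡⟨ lem (diff h k) (diff g k) (diff g h) w ⟩
      ((diff h k - diff g k) + diff g h) * w
        ≡⟨ cong (_* w) (sym (p*β g h k)) ⟩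
      (+ p * β g h k) * w
        ≡⟨ ℤₚ.*-assoc (+ p) (β g h k) w ⟩
      + p * (β g h k * w) ∎
      where
      open ≡-Reasoning
      w : ℤ
      w = wᵒ j (k ∷ l)
      lem : ∀ a b c w → a * w - (b * w - c * w) ≡ ((a - b) + c) * w
      lem = solve-∀

  wᵒ-rot : ∀ j l → wᵒ j (map rot l) ≡ wᵒ j l
  wᵒ-rot zero    l               = refl
  wᵒ-rot (suc j) (g ∷ h ∷ k ∷ l) = cong₂ _*_ (β-rot g h k) (wᵒ-rot j (k ∷ l))

  wᵉ-rot : ∀ j l → wᵉ j (map rot l) ≡ wᵉ j l
  wᵉ-rot j (g ∷ h ∷ l) = cong₂ _*_ (diff-rot g h) (wᵒ-rot j (h ∷ l))

  -- θ is not invariant: modulo p, θ ∘ s − θ = wᵒ and δθ = wᵉ, with integral corrections τ and κ.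
  θ : ∀ j → Vec Z (odd j) → ℤ
  θ j (g ∷ l) = ⟦ g ⟧ * wᵒ j (g ∷ l)

  κ : ∀ j → Vec Z (suc (odd j)) → ℤ
  κ j (g ∷ h ∷ l) = carry g h * wᵒ j (h ∷ l)

  τ : ∀ j → Vec Z (odd j) → ℤ
  τ j (g ∷ l) = top g * wᵒ j (g ∷ l)

  wᵉ≡δθ : ∀ j l → wᵉ j l ≡ δ (θ j) l + + p * κ j l
  wᵉ≡δθ j (g ∷ h ∷ l) = sym (begin
    (⟦ h ⟧ * w - δ (λ m → ⟦ g ⟧ * wᵒ j (g ∷ m)) (h ∷ l)) + + p * (carry g h * w)
      ≡⟨ cong (λ t → (⟦ h ⟧ * w - t) + + p * (carry g h * w))
           (trans (δ-scale ⟦ g ⟧ (λ m → wᵒ j (g ∷ m)) (h ∷ l))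
                  (cong (⟦ g ⟧ *_) (wᵒ-face j (δwᵒ j) g (h ∷ l)))) ⟩
    (⟦ h ⟧ * w - ⟦ g ⟧ * w) + + p * (carry g h * w)
      ≡⟨ lem ⟦ h ⟧ ⟦ g ⟧ w (+ p) (carry g h) ⟩
    diff g h * w ∎)
    where
    open ≡-Reasoning
    w : ℤ
    w = wᵒ j (h ∷ l)
    lem : ∀ h g w p c → (h * w - g * w) + p * (c * w) ≡ ((h - g) + p * c) * w
    lem = solve-∀

  θ-rot : ∀ j l → θ j (map rot l) - θ j l ≡ wᵒ j l + - (+ p) * τ j l
  θ-rot j (g ∷ l) = trans
    (cong₂ (λ a w → a * w - ⟦ g ⟧ * wᵒ j (g ∷ l)) (⟦rot⟧ g) (wᵒ-rot j (g ∷ l)))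
    (lem ⟦ g ⟧ (+ p) (top g) (wᵒ j (g ∷ l)))
    where
    lem : ∀ g p t w → (g + (1ℤ - p * t)) * w - g * w ≡ w + - p * (t * w)
    lem = solve-∀

  -- Recursive in the first letter, because `S` fixes the labels of a flag one at a time from the
  -- front.
  Normalised : ∀ {n} → (Vec Z n → ℤ) → Set
  Normalised {zero}        F = ⊤
  Normalised {suc zero}    F = ⊤
  Normalised {suc (suc n)} F = (∀ g l → F (g ∷ g ∷ l) ≡ 0ℤ) × (∀ g → Normalised (λ l → F (g ∷ l)))

  Normalised-scale : ∀ {n} c (F : Vec Z n → ℤ) → Normalised F → Normalised (λ l → c * F l)
  Normalised-scale {zero}        c F _         = tt
  Normalised-scale {suc zero}    c F _         = tt
  Normalised-scale {suc (suc n)} c F (d , rec) =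
    (λ g l → trans (cong (c *_) (d g l)) (ℤₚ.*-zeroʳ c)) , (λ g → Normalised-scale c (λ l → F (g ∷ l)) (rec g))

  β-degenerateˡ : ∀ g h → β g g h ≡ 0ℤ
  β-degenerateˡ g h rewrite carry-refl g = lem (carry g h)
    where
    lem : ∀ a → (a - a) + 0ℤ ≡ 0ℤ
    lem = solve-∀

  β-degenerateʳ : ∀ g h → β g h h ≡ 0ℤ
  β-degenerateʳ g h rewrite carry-refl h = lem (carry g h)
    where
    lem : ∀ a → (0ℤ - a) + a ≡ 0ℤ
    lem = solve-∀

  wᵒ-normalised : ∀ j → Normalised (wᵒ j)
  wᵒ-normalised zero    = tt
  wᵒ-normalised (suc j) =
    (λ { g (k ∷ l) → cong (_* wᵒ j (k ∷ l)) (β-degenerateˡ g k) }) ,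
    (λ g → (λ h l → cong (_* wᵒ j (h ∷ l)) (β-degenerateʳ g h)) ,
           (λ h → tail g h j (wᵒ-normalised j)))
    where
    tail : ∀ g h j → Normalised (wᵒ j) → Normalised (λ l → wᵒ (suc j) (g ∷ h ∷ l))
    tail g h zero    _         = tt
    tail g h (suc j) (d , rec) =
      (λ { k (m ∷ l) → trans (cong (β g h k *_) (d k (m ∷ l))) (ℤₚ.*-zeroʳ (β g h k)) }) ,
      (λ k → Normalised-scale (β g h k) (λ l → wᵒ (suc j) (k ∷ l)) (rec k))

  wᵉ-normalised : ∀ j → Normalised (wᵉ j)
  wᵉ-normalised j =
    (λ g l → cong (_* wᵒ j (g ∷ l)) (diff-refl g)) , (λ g → tail g j (wᵒ-normalised j))
    where
    tail : ∀ g j → Normalised (wᵒ j) → Normalised (λ l → wᵉ j (g ∷ l))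
    tail g zero    _         = tt
    tail g (suc j) (d , rec) =
      (λ { h (m ∷ l) → trans (cong (diff g h *_) (d h (m ∷ l))) (ℤₚ.*-zeroʳ (diff g h)) }) ,
      (λ h → Normalised-scale (diff g h) (λ l → wᵒ (suc j) (h ∷ l)) (rec h))

  -- S d X F: the value of the cochain F ∘ lab on the barycentric subdivision of X,
  -- where a flag X = X_d > ⋯ > X₁ is labelled by (lab X_d , … , lab X₁).
  module _ {n : ℕ} (lab : V n → Z) where

    S : ∀ d → V n → (Vec Z d → ℤ) → ℤ
    S zero    X F = F []
    S (suc d) X F = ∂ X (λ Y → S d Y (λ l → F (lab X ∷ l)))

    S-cong : ∀ d X {F G : Vec Z d → ℤ} → (∀ l → F l ≡ G l) → S d X F ≡ S d X G
    S-cong zero    X eq = eq []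
    S-cong (suc d) X eq = ∂-cong X (λ Y → S-cong d Y (λ l → eq (lab X ∷ l)))

    S-lin : ∀ d X c (F G : Vec Z d → ℤ) → S d X (λ l → F l + c * G l) ≡ S d X F + c * S d X G
    S-lin zero    X c F G = refl
    S-lin (suc d) X c F G =
      trans (∂-cong X (λ Y → S-lin d Y c (λ l → F (lab X ∷ l)) (λ l → G (lab X ∷ l)))) (∂-lin X c _ _)

    S-sub : ∀ d X (F G : Vec Z d → ℤ) → S d X (λ l → F l - G l) ≡ S d X F - S d X G
    S-sub zero    X F G = refl
    S-sub (suc d) X F G =
      trans (∂-cong X (λ Y → S-sub d Y (λ l → F (lab X ∷ l)) (λ l → G (lab X ∷ l)))) (∂-sub X _ _)

    S-0 : ∀ d X → S d X (λ _ → 0ℤ) ≡ 0ℤ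
    S-0 zero    X = refl
    S-0 (suc d) X = trans (∂-cong X (λ Y → S-0 d Y)) (∂-0 X)

    -- Deleting the top label leaves the subdivided boundary of X; the terms that delete a later
    -- label cancel by ∂∂ = 0.
    stokes : ∀ d X (F : Vec Z d → ℤ) → S (suc d) X (δ F) ≡ ∂ X (λ Y → S d Y F)
    stokes zero    X F = refl
    stokes (suc d) X F = begin
      ∂ X (λ Y → S (suc d) Y (λ l → F l - δ F′ l))
        ≡⟨ ∂-cong X (λ Y → S-sub (suc d) Y F (δ F′)) ⟩
      ∂ X (λ Y → S (suc d) Y F - S (suc d) Y (δ F′))
        ≡⟨ ∂-sub X _ _ ⟩
      ∂ X (λ Y → S (suc d) Y F) - ∂ X (λ Y → S (suc d) Y (δ F′))
        ≡⟨ cong (λ t → ∂ X (λ Y → S (suc d) Y F) - t)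
             (trans (∂-cong X (λ Y → stokes d Y F′)) (∂∂ X (λ Y → S d Y F′))) ⟩
      ∂ X (λ Y → S (suc d) Y F) - 0ℤ
        ≡⟨ ℤₚ.+-identityʳ _ ⟩
      ∂ X (λ Y → S (suc d) Y F) ∎
      where
      open ≡-Reasoning
      F′ : Vec Z d → ℤ
      F′ m = F (lab X ∷ m)

    S-shift : (∀ X → Nonzero X → lab (shift X) ≡ rot (lab X)) →
              ∀ d X (F : Vec Z d → ℤ) → S d (shift X) F ≡ S d X (λ l → F (map rot l))
    S-shift equiv zero    X F = refl
    S-shift equiv (suc d) X F with nonzero? X
    ... | inj₁ nz = begin
      ∂ (shift X) (λ Y → S d Y (λ l → F (lab (shift X) ∷ l)))    ≡⟨ ∂-shift X _ ⟩
      ∂ X (λ Y → S d (shift Y) (λ l → F (lab (shift X) ∷ l)))    ≡⟨ ∂-cong X (λ Y → S-shift equiv d Y _) ⟩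
      ∂ X (λ Y → S d Y (λ l → F (lab (shift X) ∷ map rot l)))    ≡⟨ cong (λ g → ∂ X (λ Y → S d Y (λ l → F (g ∷ map rot l)))) (equiv X nz) ⟩
      ∂ X (λ Y → S d Y (λ l → F (rot (lab X) ∷ map rot l)))      ∎
      where open ≡-Reasoning
    -- Nothing is known about the label of the zero vector, but its boundary vanishes.
    ... | inj₂ refl = trans (∂-shift X _) (trans (∂-replicate-nothing n _) (sym (∂-replicate-nothing n _)))

    -- A normalised cochain vanishes on a flag as soon as the rank is constant along
    -- one of its steps, which must happen when the flag is longer than the rank.
    S-vanishes : (ρ : V n → ℕ) → (∀ Y X → Y ≼ X → ρ Y ℕ.≤ ρ X) →
                 (∀ Y X → Y ≼ X → ρ Y ≡ ρ X → lab Y ≡ lab X) → (∀ X → Nonzero X → 0 ℕ.< ρ X) →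
                 ∀ d X (F : Vec Z (suc d) → ℤ) → Normalised F → ρ X ℕ.≤ d → S (suc d) X F ≡ 0ℤ
    S-vanishes ρ mono same pos zero X F norm ρ≤ with nonzero? X
    ... | inj₁ nz   = contradiction (pos X nz) (ℕₚ.≤⇒≯ ρ≤)
    ... | inj₂ refl = ∂-replicate-nothing n _
    S-vanishes ρ mono same pos (suc d) X F (degen , norm) ρ≤ =
      trans (∂-cong≼ X step) (∂-0 X)
      where
      step : ∀ Y → Y ≼ X → S (suc d) Y (λ l → F (lab X ∷ l)) ≡ 0ℤ
      step Y Y≼X with ρ Y ℕ.≟ ρ X
      ... | no ρ≢ = S-vanishes ρ mono same pos d Y _ (norm (lab X))
                      (ℕ.s≤s⁻¹ (ℕₚ.≤-trans (ℕₚ.≤∧≢⇒< (mono Y X Y≼X) ρ≢) ρ≤))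
      ... | yes ρ≡ = trans (∂-cong Y (λ W → trans (S-cong d W (λ l →
                       trans (cong (λ g → F (lab X ∷ g ∷ l)) (same Y X Y≼X ρ≡)) (degen (lab X) l))) (S-0 d W))) (∂-0 Y)

  -- Evaluation of the pulled-back generators modulo p.

  S-nothing∷ : ∀ {n} (lab : V (suc n) → Z) d x (F : Vec Z d → ℤ) →
               S lab d (nothing ∷ x) F ≡ S (λ y → lab (nothing ∷ y)) d x F
  S-nothing∷ lab zero    x F = refl
  S-nothing∷ lab (suc d) x F = ∂-cong x (λ y → S-nothing∷ lab d y _)

  Equivariant : ∀ {n} → (V n → Z) → Set
  Equivariant lab = ∀ X → Nonzero X → lab (shift X) ≡ rot (lab X)

  restrict : ∀ {n} → (V (suc n) → Z) → V n → Z
  restrict lab x = lab (nothing ∷ x)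

  restrict-equivariant : ∀ {n} {lab : V (suc n) → Z} → Equivariant lab → Equivariant (restrict lab)
  restrict-equivariant equiv x (i , a , eq) = equiv (nothing ∷ x) (suc i , a , eq)

  Wᵒ : ∀ j → (V (odd j) → Z) → ℤ
  Wᵒ j lab = Φᵒ j (λ X → S lab (odd j) X (wᵒ j))

  Wᵉ : ∀ j → (V (suc (odd j)) → Z) → ℤ
  Wᵉ j lab = Φᵉ j (λ X → S lab (suc (odd j)) X (wᵉ j))

  -- Modulo p the cocycle is δθ. Stokes moves it to the boundary (s - 1)c₂ⱼ, where equivariance
  -- turns θ ∘ s - θ into `wᵒ`; the witness collects the corrections κ and τ.
  Wᵉ≡Wᵒ : ∀ j lab → Equivariant lab →
          ∃ λ c → Wᵉ j lab ≡ Wᵒ j (restrict lab) + + p * c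
  Wᵉ≡Wᵒ j lab equiv = Φκ - Φτ , (begin
    Φᵉ j (λ X → S lab (suc (odd j)) X (wᵉ j))
      ≡⟨ Φᵉ-cong j (λ X → trans (S-cong lab (suc (odd j)) X (wᵉ≡δθ j)) (S-lin lab (suc (odd j)) X (+ p) (δ (θ j)) (κ j))) ⟩
    Φᵉ j (λ X → S lab (suc (odd j)) X (δ (θ j)) + + p * S lab (suc (odd j)) X (κ j))
      ≡⟨ Φᵉ-lin j (+ p) (λ X → S lab (suc (odd j)) X (δ (θ j))) (λ X → S lab (suc (odd j)) X (κ j)) ⟩
    Φᵉ j (λ X → S lab (suc (odd j)) X (δ (θ j))) + + p * Φκ
      ≡⟨ cong (_+ + p * Φκ) (begin
        Φᵉ j (λ X → S lab (suc (odd j)) X (δ (θ j)))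
          ≡⟨ Φᵉ-cong j (λ X → stokes lab (odd j) X (θ j)) ⟩
        Φᵉ j (λ X → ∂ X (λ Y → S lab (odd j) Y (θ j)))
          ≡⟨ Φᵉ-∂ j (λ Y → S lab (odd j) Y (θ j)) ⟩
        Φᵒ j (λ x → S lab (odd j) (nothing ∷ shift x) (θ j) - S lab (odd j) (nothing ∷ x) (θ j))
          ≡⟨ Φᵒ-cong j step ⟩
        Φᵒ j (λ x → S lab′ (odd j) x (wᵒ j) + - (+ p) * S lab′ (odd j) x (τ j))
          ≡⟨ Φᵒ-lin j (- (+ p)) (λ x → S lab′ (odd j) x (wᵒ j)) (λ x → S lab′ (odd j) x (τ j)) ⟩
        Wᵒ j lab′ + - (+ p) * Φτ ∎) ⟩
    (Wᵒ j lab′ + - (+ p) * Φτ) + + p * Φκ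
      ≡⟨ lem (Wᵒ j lab′) (+ p) Φτ Φκ ⟩
    Wᵒ j lab′ + + p * (Φκ - Φτ) ∎)
    where
    open ≡-Reasoning
    lab′ : V (odd j) → Z
    lab′ = restrict lab
    Φκ Φτ : ℤ
    Φκ = Φᵉ j (λ X → S lab (suc (odd j)) X (κ j))
    Φτ = Φᵒ j (λ x → S lab′ (odd j) x (τ j))
    lem : ∀ w p t k → (w + - p * t) + p * k ≡ w + p * (k - t)
    lem = solve-∀
    step : ∀ x → S lab (odd j) (nothing ∷ shift x) (θ j) - S lab (odd j) (nothing ∷ x) (θ j) ≡
                 S lab′ (odd j) x (wᵒ j) + - (+ p) * S lab′ (odd j) x (τ j)
    step x = begin
      S lab (odd j) (nothing ∷ shift x) (θ j) - S lab (odd j) (nothing ∷ x) (θ j)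
        ≡⟨ cong₂ _-_ (S-nothing∷ lab (odd j) (shift x) (θ j)) (S-nothing∷ lab (odd j) x (θ j)) ⟩
      S lab′ (odd j) (shift x) (θ j) - S lab′ (odd j) x (θ j)
        ≡⟨ cong (_- S lab′ (odd j) x (θ j)) (S-shift lab′ (restrict-equivariant {lab = lab} equiv) (odd j) x (θ j)) ⟩
      S lab′ (odd j) x (λ l → θ j (map rot l)) - S lab′ (odd j) x (θ j)
        ≡⟨ sym (S-sub lab′ (odd j) x (λ l → θ j (map rot l)) (θ j)) ⟩
      S lab′ (odd j) x (λ l → θ j (map rot l) - θ j l)
        ≡⟨ S-cong lab′ (odd j) x (θ-rot j) ⟩
      S lab′ (odd j) x (λ l → wᵒ j l + - (+ p) * τ j l)
        ≡⟨ S-lin lab′ (odd j) x (- (+ p)) (wᵒ j) (τ j) ⟩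
      S lab′ (odd j) x (wᵒ j) + - (+ p) * S lab′ (odd j) x (τ j) ∎

  -- After multiplication by p the cocycle is the coboundary of `wᵉ j`. Stokes moves it to the norm
  -- of c₂ⱼ₊₁, which acts on an invariant cochain as multiplication by p, and p cancels.
  Wᵒ≡Wᵉ : ∀ j lab → Equivariant lab → Wᵒ (suc j) lab ≡ Wᵉ j (restrict lab)
  Wᵒ≡Wᵉ j lab equiv = ℤₚ.*-cancelˡ-≡ (+ p) (Wᵒ (suc j) lab) (Wᵉ j lab′) (begin
    + p * Wᵒ (suc j) lab
      ≡⟨ scale ⟩
    Φᵒ (suc j) (λ X → S lab (odd (suc j)) X (λ l → + p * wᵒ (suc j) l))
      ≡⟨ Φᵒ-cong (suc j) (λ X → trans (S-cong lab (odd (suc j)) X (λ l → sym (δwᵉ j l))) (stokes lab (suc (odd j)) X (wᵉ j))) ⟩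
    Φᵒ (suc j) (λ X → ∂ X (λ Y → S lab (suc (odd j)) Y (wᵉ j)))
      ≡⟨ Φᵒ-∂ j (λ Y → S lab (suc (odd j)) Y (wᵉ j)) ⟩
    Φᵉ j (orb p (λ y → S lab (suc (odd j)) (nothing ∷ y) (wᵉ j)))
      ≡⟨ Φᵉ-cong j (λ x → trans (orb-cong p (λ y → S-nothing∷ lab (suc (odd j)) y (wᵉ j)) x)
                                (orb-invariant p (λ y → S lab′ (suc (odd j)) y (wᵉ j)) invariant x)) ⟩
    Φᵉ j (λ x → + p * S lab′ (suc (odd j)) x (wᵉ j))
      ≡⟨ scaleᵉ ⟩
    + p * Wᵉ j lab′ ∎)
    where
    open ≡-Reasoning
    lab′ : V (suc (odd j)) → Z
    lab′ = restrict lab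
    invariant : ∀ y → S lab′ (suc (odd j)) (shift y) (wᵉ j) ≡ S lab′ (suc (odd j)) y (wᵉ j)
    invariant y = trans (S-shift lab′ (restrict-equivariant {lab = lab} equiv) (suc (odd j)) y (wᵉ j))
                        (S-cong lab′ (suc (odd j)) y (wᵉ-rot j))
    scale : + p * Wᵒ (suc j) lab ≡ Φᵒ (suc j) (λ X → S lab (odd (suc j)) X (λ l → + p * wᵒ (suc j) l))
    scale = sym (begin
      Φᵒ (suc j) (λ X → S lab (odd (suc j)) X (λ l → + p * wᵒ (suc j) l))
        ≡⟨ Φᵒ-cong (suc j) (λ X → begin
             S lab (odd (suc j)) X (λ l → + p * wᵒ (suc j) l)
               ≡⟨ S-cong lab (odd (suc j)) X (λ l → sym (ℤₚ.+-identityˡ (+ p * wᵒ (suc j) l))) ⟩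
             S lab (odd (suc j)) X (λ l → 0ℤ + + p * wᵒ (suc j) l)
               ≡⟨ S-lin lab (odd (suc j)) X (+ p) (λ _ → 0ℤ) (wᵒ (suc j)) ⟩
             S lab (odd (suc j)) X (λ _ → 0ℤ) + + p * S lab (odd (suc j)) X (wᵒ (suc j))
               ≡⟨ cong (_+ + p * S lab (odd (suc j)) X (wᵒ (suc j))) (S-0 lab (odd (suc j)) X) ⟩
             0ℤ + + p * S lab (odd (suc j)) X (wᵒ (suc j)) ∎) ⟩
      Φᵒ (suc j) (λ X → 0ℤ + + p * S lab (odd (suc j)) X (wᵒ (suc j)))
        ≡⟨ Φᵒ-lin (suc j) (+ p) (λ _ → 0ℤ) (λ X → S lab (odd (suc j)) X (wᵒ (suc j))) ⟩
      Φᵒ (suc j) (λ _ → 0ℤ) + + p * Wᵒ (suc j) lab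
        ≡⟨ cong (_+ + p * Wᵒ (suc j) lab) (Φᵒ-0 (suc j)) ⟩
      0ℤ + + p * Wᵒ (suc j) lab
        ≡⟨ ℤₚ.+-identityˡ (+ p * Wᵒ (suc j) lab) ⟩
      + p * Wᵒ (suc j) lab ∎)
    scaleᵉ : Φᵉ j (λ x → + p * S lab′ (suc (odd j)) x (wᵉ j)) ≡ + p * Wᵉ j lab′
    scaleᵉ = begin
      Φᵉ j (λ x → + p * S lab′ (suc (odd j)) x (wᵉ j))
        ≡⟨ Φᵉ-cong j (λ x → sym (ℤₚ.+-identityˡ (+ p * S lab′ (suc (odd j)) x (wᵉ j)))) ⟩
      Φᵉ j (λ x → 0ℤ + + p * S lab′ (suc (odd j)) x (wᵉ j))
        ≡⟨ Φᵉ-lin j (+ p) (λ _ → 0ℤ) (λ x → S lab′ (suc (odd j)) x (wᵉ j)) ⟩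
      Φᵉ j (λ _ → 0ℤ) + + p * Wᵉ j lab′
        ≡⟨ cong (_+ + p * Wᵉ j lab′) (Φᵉ-0 j) ⟩
      0ℤ + + p * Wᵉ j lab′
        ≡⟨ ℤₚ.+-identityˡ (+ p * Wᵉ j lab′) ⟩
      + p * Wᵉ j lab′ ∎

  mutual
    -- Coordinates are removed one at a time by restricting the labelling, down to a single vertex,
    -- where the value is 1.
    Wᵒ≡1modp : ∀ j lab → Equivariant lab → ∃ λ c → Wᵒ j lab ≡ 1ℤ + + p * c
    Wᵒ≡1modp zero    lab equiv = 0ℤ , sym (cong (λ t → 1ℤ + t) (ℤₚ.*-zeroʳ (+ p)))
    Wᵒ≡1modp (suc j) lab equiv = proj₁ rec , trans (Wᵒ≡Wᵉ j lab equiv) (proj₂ rec)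
      where
      rec : ∃ λ c → Wᵉ j (restrict lab) ≡ 1ℤ + + p * c
      rec = Wᵉ≡1modp j (restrict lab) (restrict-equivariant {lab = lab} equiv)

    Wᵉ≡1modp : ∀ j lab → Equivariant lab → ∃ λ c → Wᵉ j lab ≡ 1ℤ + + p * c
    Wᵉ≡1modp j lab equiv =
      proj₁ rec + proj₁ step , trans (proj₂ step)
        (trans (cong (_+ + p * proj₁ step) (proj₂ rec)) (lem (+ p) (proj₁ rec) (proj₁ step)))
      where
      rec : ∃ λ c → Wᵒ j (restrict lab) ≡ 1ℤ + + p * c
      rec = Wᵒ≡1modp j (restrict lab) (restrict-equivariant {lab = lab} equiv)
      step : ∃ λ c → Wᵉ j lab ≡ Wᵒ j (restrict lab) + + p * c
      step = Wᵉ≡Wᵒ j lab equiv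
      lem : ∀ p c d → (1ℤ + p * c) + p * d ≡ 1ℤ + p * (c + d)
      lem = solve-∀

  0≢1modp : 1 ℕ.≤ q → ∀ c → 0ℤ ≢ 1ℤ + + p * c
  0≢1modp 1≤q c eq = contradiction
    (∣⇒≤ (∣⇒∣ᵤ (divides (- c) 1≡))) (ℕₚ.<⇒≱ (s≤s 1≤q))
    where
    lem : ∀ p c → 1ℤ ≡ (1ℤ + p * c) + (- c) * p
    lem = solve-∀
    1≡ : 1ℤ ≡ - c * + p
    1≡ = trans (lem (+ p) c) (trans (cong (_+ - c * + p) (sym eq)) (ℤₚ.+-identityˡ _))

  parity : ∀ n → (∃ λ j → n ≡ even j) ⊎ (∃ λ j → n ≡ odd j)
  parity zero    = inj₁ (zero , refl)
  parity (suc n) with parity n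
  ... | inj₁ (j , eq) = inj₂ (j , cong suc eq)
  ... | inj₂ (j , eq) = inj₁ (suc j , cong suc eq)

  -- For n > 0 the pulled-back generator has the value 1 modulo p by equivariance and 0 by
  -- `S-vanishes`. For n = 0 the rank bound already fails at the empty vector.
  tucker : 1 ℕ.≤ q → ∀ n (lab : V n → Z) → Equivariant lab → (ρ : V n → ℕ) →
           (∀ Y X → Y ≼ X → ρ Y ℕ.≤ ρ X) →
           (∀ Y X → Y ≼ X → ρ Y ≡ ρ X → lab Y ≡ lab X) →
           (∀ X → Nonzero X → 0 ℕ.< ρ X) → ¬ (∀ X → ρ X ℕ.< n)
  tucker 1≤q n lab equiv ρ mono same pos bound with parity n
  ... | inj₁ (zero , refl) = contradiction (bound []) λ ()
  ... | inj₁ (suc j , refl) =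
    0≢1modp 1≤q (proj₁ (Wᵉ≡1modp j lab equiv)) (trans (sym vanish) (proj₂ (Wᵉ≡1modp j lab equiv)))
    where
    vanish : Wᵉ j lab ≡ 0ℤ
    vanish = trans (Φᵉ-cong j (λ X → S-vanishes lab ρ mono same pos (odd j) X (wᵉ j) (wᵉ-normalised j) (ℕ.s≤s⁻¹ (bound X)))) (Φᵉ-0 j)
  ... | inj₂ (j , refl) =
    0≢1modp 1≤q (proj₁ (Wᵒ≡1modp j lab equiv)) (trans (sym vanish) (proj₂ (Wᵒ≡1modp j lab equiv)))
    where
    vanish : Wᵒ j lab ≡ 0ℤ
    vanish = trans (Φᵒ-cong j (λ X → S-vanishes lab ρ mono same pos (even j) X (wᵒ j) (wᵒ-normalised j) (ℕ.s≤s⁻¹ (bound X)))) (Φᵒ-0 j)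

-- The abstract lower bound and its multiplicativity in r.

infix 4 _⊑_
_⊑_ : ∀ {n} → (Fin n → Bool) → (Fin n → Bool) → Set
A ⊑ B = ∀ x → A x ≡ true → B x ≡ true

does⁻ : ∀ {A : Set} (d : Dec A) → does d ≡ true → A
does⁻ (yes a) _ = a

image : ∀ {k n} → (Fin k → Fin n) → (Fin k → Bool) → Fin n → Bool
image e A y = does (any? (λ x → (A x ≟ᵇ true) ×-dec (e x ≟ y)))

∈-image : ∀ {k n} (e : Fin k → Fin n) A {x} → A x ≡ true → image e A (e x) ≡ true
∈-image e A {x} Ax = dec-true (any? _) (x , Ax , refl)

∈-image⁻ : ∀ {k n} (e : Fin k → Fin n) A y → image e A y ≡ true → ∃ λ x → A x ≡ true × e x ≡ y
∈-image⁻ e A y = does⁻ (any? _)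

fibre : ∀ {r n} → Vec (Fin r) n → Fin r → Fin n → Bool
fibre f i x = does (lookup f x ≟ i)

-- Maps into `Fin r` are stored as vectors so that they can be searched exhaustively without
-- function extensionality.
∃Vec? : ∀ {r n} {P : Vec (Fin r) n → Set} → (∀ f → Dec (P f)) → Dec (∃ P)
∃Vec? {n = zero}  P? = map′ ([] ,_) (λ { ([] , h) → h }) (P? [])
∃Vec? {n = suc n} P? = map′ (λ { (a , f , h) → a ∷ f , h }) (λ { (a ∷ f , h) → a , f , h })
  (any? (λ a → ∃Vec? (λ f → P? (a ∷ f))))

-- Q c A stands for “A contains an admissible (k₀ + 1)-set of colour c”; working with an abstract Q
-- lets the same statement be used for the sets coloured through their r₁ monochromatic subsets.
-- pos witnesses that all blocks have at most r elements, and the inequality is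
-- r(k − 1) + (r − 1)m < n with m added on both sides.
LowerBound : ℕ → Set₁
LowerBound r =
  ∀ {n ℓ m} k₀ (blk : Fin n → Fin ℓ) (pos : Fin n → Fin r) →
  (∀ x y → blk x ≡ blk y → pos x ≡ pos y → x ≡ y) →
  r ℕ.* (k₀ ℕ.+ m) ℕ.< n ℕ.+ m →
  (Q : Fin m → (Fin n → Bool) → Set) →
  (∀ c A → Dec (Q c A)) →
  (∀ c {A B} → A ⊑ B → Q c A → Q c B) →
  (∀ (e : Fin (suc k₀) → Fin n) → (∀ i j → blk (e i) ≡ blk (e j) → i ≡ j) →
     ∃ λ c → Q c (image e (λ _ → true))) →
  ∃₂ λ c (f : Vec (Fin r) n) → ∀ i → Q c (fibre f i)

-- For r = 1 blocks are singletons and the inequality says k₀ < n, so the first k₀ + 1 points are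
-- admissible and the whole ground set is the single class.
lowerBound-1 : LowerBound 1
lowerBound-1 {n} {ℓ} {m} k₀ blk pos inj lt Q Q? mono cover =
  proj₁ covered , replicate n zero , λ i → mono (proj₁ covered) (λ x _ → all i x) (proj₂ covered)
  where
  k₀<n : suc k₀ ℕ.≤ n
  k₀<n = ℕₚ.+-cancelʳ-< m k₀ n (subst (ℕ._< n ℕ.+ m) (ℕₚ.*-identityˡ (k₀ ℕ.+ m)) lt)
  pos-irrelevant : ∀ (i j : Fin 1) → i ≡ j
  pos-irrelevant zero zero = refl
  covered : ∃ λ c → Q c (image (λ i → inject≤ i k₀<n) (λ _ → true))
  covered = cover (λ i → inject≤ i k₀<n)
    (λ i j eq → Finₚ.inject≤-injective k₀<n k₀<n i j (inj _ _ eq (pos-irrelevant _ _)))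
  all : ∀ i x → fibre (replicate n zero) i x ≡ true
  all i x = dec-true (lookup (replicate n zero) x ≟ i) (pos-irrelevant _ _)

∩-elim : ∀ {a b} → a ∧ b ≡ true → a ≡ true × b ≡ true
∩-elim {true} {true} refl = refl , refl

∩-intro : ∀ {a b} → a ≡ true → b ≡ true → a ∧ b ≡ true
∩-intro refl refl = refl

combineFibres : ∀ {r₁ r₂ n} (f : Vec (Fin r₂) n) (g : Fin r₂ → Vec (Fin r₁) n) →
                ∃ λ (F : Vec (Fin (r₁ ℕ.* r₂)) n) → ∀ t → let a , b = remQuot {r₁} r₂ t in
                (λ x → fibre (g b) a x ∧ fibre f b x) ⊑ fibre F t
combineFibres {r₁} {r₂} {n} f g = tabulate F , fibres⊑
  where
  open ≡-Reasoning
  F : Fin n → Fin (r₁ ℕ.* r₂)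
  F x = combine (lookup (g (lookup f x)) x) (lookup f x)
  fibres⊑ : ∀ t → let a , b = remQuot {r₁} r₂ t in
            (λ x → fibre (g b) a x ∧ fibre f b x) ⊑ fibre (tabulate F) t
  fibres⊑ t x x∈ = dec-true (lookup (tabulate F) x ≟ t) (begin
    lookup (tabulate F) x                              ≡⟨ lookup∘tabulate F x ⟩
    combine (lookup (g (lookup f x)) x) (lookup f x)   ≡⟨ cong (λ b → combine (lookup (g b) x) b) (does⁻ (lookup f x ≟ t₂) (proj₂ (∩-elim x∈))) ⟩
    combine (lookup (g t₂) x) t₂                       ≡⟨ cong (λ a → combine a t₂) (does⁻ (lookup (g t₂) x ≟ t₁) (proj₁ (∩-elim x∈))) ⟩
    combine t₁ t₂                                      ≡⟨ Finₚ.combine-remQuot {r₁} r₂ t ⟩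
    t                                                  ∎)
    where
    t₁ : Fin r₁
    t₁ = proj₁ (remQuot {r₁} r₂ t)
    t₂ : Fin r₂
    t₂ = proj₂ (remQuot {r₁} r₂ t)

lowerBound-* : ∀ {r₁ r₂} → 1 ℕ.≤ r₁ → LowerBound r₁ → LowerBound r₂ → LowerBound (r₁ ℕ.* r₂)
lowerBound-* {r₁} {r₂} 1≤r₁ bound₁ bound₂ {n} {ℓ} {m} k₀ blk pos inj lt Q Q? mono cover =
  let c , f , h = step₂
      F , fibres⊑ = combineFibres f (λ b → proj₁ (h b))
  in c , F , λ t → mono c (fibres⊑ t) (proj₂ (h (proj₂ (remQuot {r₁} r₂ t))) (proj₁ (remQuot {r₁} r₂ t)))
  where
  -- `hi` names a piece of the block and `lo` the position inside that piece. A set admissible for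
  -- the pieces meets an original block in at most r₁ points, which `hi` separates.
  hi : Fin n → Fin r₁
  hi x = proj₁ (remQuot {r₁} r₂ (pos x))
  lo : Fin n → Fin r₂
  lo x = proj₂ (remQuot {r₁} r₂ (pos x))

  blk′ : Fin n → Fin (ℓ ℕ.* r₁)
  blk′ x = combine (blk x) (hi x)

  blk′-injective : ∀ x y → blk′ x ≡ blk′ y → blk x ≡ blk y × hi x ≡ hi y
  blk′-injective x y eq = Finₚ.combine-injective (blk x) (hi x) (blk y) (hi y) eq

  inj′ : ∀ x y → blk′ x ≡ blk′ y → lo x ≡ lo y → x ≡ y
  inj′ x y eq lo≡ = inj x y (proj₁ (blk′-injective x y eq)) (begin
    pos x                     ≡⟨ sym (Finₚ.combine-remQuot {r₁} r₂ (pos x)) ⟩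
    combine (hi x) (lo x)     ≡⟨ cong₂ combine (proj₂ (blk′-injective x y eq)) lo≡ ⟩
    combine (hi y) (lo y)     ≡⟨ Finₚ.combine-remQuot {r₁} r₂ (pos y) ⟩
    pos y                     ∎)
    where open ≡-Reasoning

  -- With this value k₁ + 1 points just satisfy the inequality for r₁, while the inequality for r₂
  -- and k₁ is the given one. The subtraction is exact because r₁ ≥ 1.
  k₁ : ℕ
  k₁ = r₁ ℕ.* (k₀ ℕ.+ m) ℕ.∸ m

  k₁+m : k₁ ℕ.+ m ≡ r₁ ℕ.* (k₀ ℕ.+ m)
  k₁+m = ℕₚ.m∸n+n≡m (ℕₚ.≤-trans (ℕₚ.m≤n+m m k₀)
    (ℕₚ.≤-trans (ℕₚ.≤-reflexive (sym (ℕₚ.*-identityˡ _))) (ℕₚ.*-monoˡ-≤ (k₀ ℕ.+ m) 1≤r₁)))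

  Q′ : Fin m → (Fin n → Bool) → Set
  Q′ c A = ∃ λ (g : Vec (Fin r₁) n) → ∀ i → Q c (λ x → fibre g i x ∧ A x)

  lt′ : r₂ ℕ.* (k₁ ℕ.+ m) ℕ.< n ℕ.+ m
  lt′ = subst (ℕ._< n ℕ.+ m) (begin
    (r₁ ℕ.* r₂) ℕ.* (k₀ ℕ.+ m)   ≡⟨ cong (ℕ._* (k₀ ℕ.+ m)) (ℕₚ.*-comm r₁ r₂) ⟩
    (r₂ ℕ.* r₁) ℕ.* (k₀ ℕ.+ m)   ≡⟨ ℕₚ.*-assoc r₂ r₁ (k₀ ℕ.+ m) ⟩
    r₂ ℕ.* (r₁ ℕ.* (k₀ ℕ.+ m))   ≡⟨ cong (r₂ ℕ.*_) (sym k₁+m) ⟩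
    r₂ ℕ.* (k₁ ℕ.+ m)            ∎) lt
    where open ≡-Reasoning

  module Cover (e : Fin (suc k₁) → Fin n) (e-inj : ∀ i j → blk′ (e i) ≡ blk′ (e j) → i ≡ j) where
    open ≡-Reasoning

    image-mono : ∀ {A B} → A ⊑ B → image e A ⊑ image e B
    image-mono {A} {B} A⊑B y y∈ = let x , Ax , ex = ∈-image⁻ e A y y∈ in
      subst (λ z → image e B z ≡ true) ex (∈-image e B (A⊑B x Ax))

    image-∘ : ∀ {k} (e′ : Fin k → Fin (suc k₁)) →
              image (e ∘ e′) (λ _ → true) ⊑ image e (image e′ (λ _ → true))
    image-∘ e′ y y∈ = let x , _ , ex = ∈-image⁻ (e ∘ e′) (λ _ → true) y y∈ in
      subst (λ z → image e (image e′ (λ _ → true)) z ≡ true) ex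
        (∈-image e (image e′ (λ _ → true)) (∈-image e′ (λ _ → true) refl))

    step₁ : ∃₂ λ c (g : Vec (Fin r₁) (suc k₁)) → ∀ i → Q c (image e (fibre g i))
    step₁ = bound₁ k₀ (blk ∘ e) (hi ∘ e)
      (λ x y blk≡ hi≡ → e-inj x y (cong₂ combine blk≡ hi≡))
      (s≤s (ℕₚ.≤-reflexive (sym k₁+m)))
      (λ c B → Q c (image e B)) (λ c B → Q? c (image e B))
      (λ c A⊑B → mono c (image-mono A⊑B))
      (λ e′ e′-inj → let c , Qc = cover (e ∘ e′) e′-inj in c , mono c (image-∘ e′) Qc)

    g : Vec (Fin r₁) (suc k₁)
    g = proj₁ (proj₂ step₁)

    -- Transports g along e. The default off the image of e is harmless, since `Q′` intersects each
    -- fibre with that image.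
    ĝ : Fin n → Fin r₁
    ĝ y with any? (λ x → e x ≟ y)
    ... | yes (x , _) = lookup g x
    ... | no  _       = fromℕ< 1≤r₁

    ĝ∘e : ∀ x → ĝ (e x) ≡ lookup g x
    ĝ∘e x with any? (λ x′ → e x′ ≟ e x)
    ... | yes (x′ , eq) = cong (lookup g) (e-inj x′ x (cong blk′ eq))
    ... | no  none      = contradiction (x , refl) none

    image⊑fibre : ∀ i → image e (fibre g i) ⊑ (λ y → fibre (tabulate ĝ) i y ∧ image e (λ _ → true) y)
    image⊑fibre i y y∈ = let x , gx , ex = ∈-image⁻ e (fibre g i) y y∈ in
      ∩-intro
        (dec-true (lookup (tabulate ĝ) y ≟ i) (begin
          lookup (tabulate ĝ) y ≡⟨ lookup∘tabulate ĝ y ⟩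
          ĝ y                   ≡⟨ cong ĝ (sym ex) ⟩
          ĝ (e x)               ≡⟨ ĝ∘e x ⟩
          lookup g x            ≡⟨ does⁻ (lookup g x ≟ i) gx ⟩
          i                     ∎))
        (subst (λ z → image e (λ _ → true) z ≡ true) ex (∈-image e (λ _ → true) {x} refl))

    covered : ∃ λ c → Q′ c (image e (λ _ → true))
    covered = proj₁ step₁ , tabulate ĝ , λ i → mono (proj₁ step₁) (image⊑fibre i) (proj₂ (proj₂ step₁) i)

  step₂ : ∃₂ λ c (f : Vec (Fin r₂) n) → ∀ i → Q′ c (fibre f i)
  step₂ = bound₂ k₁ blk′ lo inj′ lt′ Q′
    (λ c A → ∃Vec? (λ g → all? (λ i → Q? c (λ x → fibre g i x ∧ A x))))
    (λ c A⊑B (g , h) → g , λ i → mono c (λ x x∈ →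
       let x∈g , x∈A = ∩-elim x∈ in ∩-intro x∈g (A⊑B x x∈A)) (h i))
    Cover.covered

-- Sums and counting over finite sets.

bit : Bool → ℕ
bit true  = 1
bit false = 0

count : ∀ {n} → (Fin n → Bool) → ℕ
count A = sum (bit ∘ A)

sum-mono : ∀ {n} {f g : Fin n → ℕ} → (∀ i → f i ℕ.≤ g i) → sum f ℕ.≤ sum g
sum-mono {zero}  le = z≤n
sum-mono {suc n} le = ℕₚ.+-mono-≤ (le zero) (sum-mono (le ∘ suc))

sum-mono-≡ : ∀ {n} {f g : Fin n → ℕ} → (∀ i → f i ℕ.≤ g i) → sum f ≡ sum g → ∀ i → f i ≡ g i
sum-mono-≡ {suc n} {f} {g} le eq i = go i
  where
  tails : sum (f ∘ suc) ≡ sum (g ∘ suc)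
  tails = ℕₚ.≤-antisym (sum-mono (le ∘ suc))
    (ℕₚ.+-cancelˡ-≤ (g zero) _ _ (ℕₚ.≤-trans (ℕₚ.≤-reflexive (sym eq)) (ℕₚ.+-monoˡ-≤ _ (le zero))))
  go : ∀ i → f i ≡ g i
  go zero    = ℕₚ.+-cancelʳ-≡ (sum (g ∘ suc)) (f zero) (g zero)
                 (trans (cong (f zero ℕ.+_) (sym tails)) eq)
  go (suc i) = sum-mono-≡ (le ∘ suc) tails i

sum-const : ∀ n a → sum {n} (λ _ → a) ≡ n ℕ.* a
sum-const zero    a = refl
sum-const (suc n) a = cong (a ℕ.+_) (sum-const n a)

sum-suc : ∀ {n} (f : Fin n → ℕ) → sum f ℕ.+ n ≡ sum (suc ∘ f)
sum-suc {zero}  f = refl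
sum-suc {suc n} f = begin
  (f zero ℕ.+ sum (f ∘ suc)) ℕ.+ suc n   ≡⟨ ℕₚ.+-suc _ n ⟩
  suc ((f zero ℕ.+ sum (f ∘ suc)) ℕ.+ n) ≡⟨ cong suc (ℕₚ.+-assoc (f zero) _ n) ⟩
  suc (f zero ℕ.+ (sum (f ∘ suc) ℕ.+ n)) ≡⟨ cong (λ t → suc (f zero ℕ.+ t)) (sum-suc (f ∘ suc)) ⟩
  suc (f zero ℕ.+ sum (suc ∘ f ∘ suc))   ∎
  where open ≡-Reasoning

term≤sum : ∀ {n} (f : Fin n → ℕ) i → f i ℕ.≤ sum f
term≤sum f zero    = ℕₚ.m≤m+n _ _
term≤sum f (suc i) = ℕₚ.≤-trans (term≤sum (f ∘ suc) i) (ℕₚ.m≤n+m _ _)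

bit-mono : ∀ {a b} → (a ≡ true → b ≡ true) → bit a ℕ.≤ bit b
bit-mono {true}  imp rewrite imp refl = ℕₚ.≤-refl
bit-mono {false} imp = z≤n

bit-injective : ∀ {a b} → bit a ≡ bit b → a ≡ b
bit-injective {true}  {true}  _ = refl
bit-injective {false} {false} _ = refl

bit≤1 : ∀ a → bit a ℕ.≤ 1
bit≤1 true  = ℕₚ.≤-refl
bit≤1 false = z≤n

count-positive : ∀ {n} (A : Fin n → Bool) i → A i ≡ true → 0 ℕ.< count A
count-positive A i Ai = ℕₚ.≤-trans (ℕₚ.≤-reflexive (cong bit (sym Ai))) (term≤sum (bit ∘ A) i)

count-proper : ∀ {n} (A : Fin n → Bool) i → A i ≡ false → count A ℕ.< n
count-proper {suc n} A zero    Ai rewrite Ai = s≤s (ℕₚ.≤-trans (sum-mono (bit≤1 ∘ A ∘ suc))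
  (ℕₚ.≤-reflexive (trans (sum-const n 1) (ℕₚ.*-identityʳ n))))
count-proper {suc n} A (suc i) Ai = ℕₚ.+-mono-≤-< (bit≤1 (A zero)) (count-proper (A ∘ suc) i Ai)

-- Integer sums and minima.

module IntegerSums where
  open Int using (_+_; _-_; _*_; _≤_; _≤?_)

  argmin : ∀ {n} → (Fin (suc n) → ℤ) → Fin (suc n)
  argmin {zero}  f = zero
  argmin {suc n} f with f zero ≤? f (suc (argmin (f ∘ suc)))
  ... | yes _ = zero
  ... | no  _ = suc (argmin (f ∘ suc))

  argmin-≤ : ∀ {n} (f : Fin (suc n) → ℤ) i → f (argmin f) ≤ f i
  argmin-≤ {zero}  f zero = ℤₚ.≤-refl
  argmin-≤ {suc n} f i with f zero ≤? f (suc (argmin (f ∘ suc))) | i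
  ... | yes _  | zero  = ℤₚ.≤-refl
  ... | yes le | suc i = ℤₚ.≤-trans le (argmin-≤ (f ∘ suc) i)
  ... | no ¬le | zero  = ℤₚ.<⇒≤ (ℤₚ.≰⇒> ¬le)
  ... | no  _  | suc i = argmin-≤ (f ∘ suc) i

  -- Injectivity frees the minimiser from the order of the search, so it can be transported along
  -- symmetries.
  argmin-unique : ∀ {n} (f : Fin (suc n) → ℤ) → (∀ i j → f i ≡ f j → i ≡ j) →
                  ∀ a → (∀ i → f a ≤ f i) → argmin f ≡ a
  argmin-unique f inj a least = inj (argmin f) a (ℤₚ.≤-antisym (argmin-≤ f a) (least (argmin f)))

  sumᶻ-+ : ∀ {n} (f : Fin n → ℕ) → sumᶻ (λ i → + f i) ≡ + sum f
  sumᶻ-+ {zero}  f = refl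
  sumᶻ-+ {suc n} f = cong (λ t → + f zero + t) (sumᶻ-+ (f ∘ suc))

  -- Splits the cost of a base point into a constant, a part linear in the base point, and a
  -- multiple of p.
  sumᶻ-affine : ∀ {n} (b u c : Fin n → ℤ) a p →
                sumᶻ (λ j → b j * ((u j - a) + p * c j)) ≡
                (sumᶻ (λ j → b j * u j) - sumᶻ b * a) + p * sumᶻ (λ j → b j * c j)
  sumᶻ-affine {zero}  b u c a p = lem a p
    where
    lem : ∀ a p → 0ℤ ≡ (0ℤ - 0ℤ * a) + p * 0ℤ
    lem = solve-∀
  sumᶻ-affine {suc n} b u c a p = trans
    (cong (λ t → b zero * ((u zero - a) + p * c zero) + t) (sumᶻ-affine (b ∘ suc) (u ∘ suc) (c ∘ suc) a p))
    (lem (b zero) (u zero) (c zero) a p (sumᶻ (λ j → b (suc j) * u (suc j))) (sumᶻ (b ∘ suc)) (sumᶻ (λ j → b (suc j) * c (suc j))))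
    where
    lem : ∀ b u c a p U B C → b * ((u - a) + p * c) + ((U - B * a) + p * C) ≡
          ((b * u + U) - (b + B) * a) + p * (b * c + C)
    lem = solve-∀

-- Equivariant choice of a sign from a set of signs.

module SetLabel (q : ℕ) where
  open Int using (_+_; _-_; _*_; _≤_) renaming (∣_∣ to abs)
  open IntegerSums
  open Cyclic q

  rot-rot^q : ∀ g → rot (rot^ q g) ≡ g
  rot-rot^q g = trans (sym (rot^-+ q 1 g)) (trans (cong (λ i → rot^ i g) (ℕₚ.+-comm q 1)) (rot^-p g))


  rot-injective : ∀ {g h} → rot g ≡ rot h → g ≡ h
  rot-injective {g} {h} eq = trans (sym (rot^-p g)) (trans (cong (rot^ q) eq) (rot^-p h))

  rotation : Permutation′ p
  rotation = permutation rot (rot^ q) rot-rot^q rot^-p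

  count-rot : ∀ {A B : Z → Bool} → (∀ i → B (rot i) ≡ A i) → count B ≡ count A
  count-rot {A} {B} eq = trans (sum-permute (bit ∘ B) rotation) (sum-cong-≗ (cong bit ∘ eq))

  -- The total forward distance around the cycle from i to the points of A.
  cost : (Z → Bool) → Z → ℤ
  cost A i = sumᶻ (λ j → + bit (A j) * diff i j)

  cost-rot : ∀ {A B : Z → Bool} → (∀ i → B (rot i) ≡ A i) → ∀ i → cost B (rot i) ≡ cost A i
  cost-rot {A} {B} eq i = trans (sumᶻ-permute (λ j → + bit (B j) * diff (rot i) j) rotation)
    (sumᶻ-cong (λ j → cong₂ (λ a d → + bit a * d) (eq j) (diff-rot i j)))

  Nonempty Full : (Z → Bool) → Set
  Nonempty A = ∃ λ i → A i ≡ true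
  Full     A = ∀ i → A i ≡ true

  nonempty? : ∀ A → Dec (Nonempty A)
  nonempty? A = any? (λ i → A i ≟ᵇ true)

  full? : ∀ A → Dec (Full A)
  full? A = all? (λ i → A i ≟ᵇ true)

  count<p : ∀ A → ¬ Full A → count A ℕ.< p
  count<p A ¬full with Finₚ.¬∀⟶∃¬ p (λ i → A i ≡ true) (λ i → A i ≟ᵇ true) ¬full
  ... | i , Ai≢ = count-proper A i (≢true Ai≢)
    where
    ≢true : ∀ {a} → a ≢ true → a ≡ false
    ≢true {true}  ne = contradiction refl ne
    ≢true {false} ne = refl

  -- Modulo p, the cost of i is (Σ A) − |A| i, which determines i because 0 < |A| < p.
  cost-injective : Prime p → ∀ A → Nonempty A → ¬ Full A → ∀ i j → cost A i ≡ cost A j → i ≡ j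
  cost-injective prime-p A (a , Aa) ¬full i j eq =
    [ (λ p∣count → contradiction
        (∣⇒≤ {{ℕ.>-nonZero (count-positive A a Aa)}} p∣count) (ℕₚ.<⇒≱ (count<p A ¬full)))
    , (λ p∣diff → Finₚ.toℕ-injective (ℤₚ.+-injective (ℤₚ.i-j≡0⇒i≡j ⟦ i ⟧ ⟦ j ⟧ (ℤₚ.∣i∣≡0⇒i≡0 (zero-if-small <p p∣diff)))))
    ]′ (euclidsLemma (count A) (abs (⟦ i ⟧ - ⟦ j ⟧)) prime-p p∣)
    where
    U B : ℤ
    U = sumᶻ (λ k → + bit (A k) * ⟦ k ⟧)
    B = sumᶻ (λ k → + bit (A k))
    C : Z → ℤ
    C i = sumᶻ (λ k → + bit (A k) * carry i k)
    affine : ∀ i → cost A i ≡ (U - B * ⟦ i ⟧) + + p * C i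
    affine i = sumᶻ-affine (λ k → + bit (A k)) ⟦_⟧ (carry i) ⟦ i ⟧ (+ p)
    lem₁ : ∀ U B i j p Ci Cj → B * (i - j) ≡ (Ci - Cj) * p + (((U - B * j) + p * Cj) - ((U - B * i) + p * Ci))
    lem₁ = solve-∀
    signed : + count A * (⟦ i ⟧ - ⟦ j ⟧) ≡ (C i - C j) * + p
    signed = begin
      + count A * (⟦ i ⟧ - ⟦ j ⟧)
        ≡⟨ cong (_* (⟦ i ⟧ - ⟦ j ⟧)) (sym (sumᶻ-+ (bit ∘ A))) ⟩
      B * (⟦ i ⟧ - ⟦ j ⟧)
        ≡⟨ lem₁ U B ⟦ i ⟧ ⟦ j ⟧ (+ p) (C i) (C j) ⟩
      (C i - C j) * + p + (((U - B * ⟦ j ⟧) + + p * C j) - ((U - B * ⟦ i ⟧) + + p * C i))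
        ≡⟨ cong (λ t → (C i - C j) * + p + t) (ℤₚ.i≡j⇒i-j≡0 (trans (sym (affine j)) (trans (sym eq) (affine i)))) ⟩
      (C i - C j) * + p + 0ℤ
        ≡⟨ ℤₚ.+-identityʳ ((C i - C j) * + p) ⟩
      (C i - C j) * + p ∎
      where open ≡-Reasoning
    p∣ : p ∣ count A ℕ.* abs (⟦ i ⟧ - ⟦ j ⟧)
    p∣ = subst (p ∣_) (ℤₚ.abs-* (+ count A) (⟦ i ⟧ - ⟦ j ⟧)) (∣⇒∣ᵤ (divides (C i - C j) signed))
    <p : abs (⟦ i ⟧ - ⟦ j ⟧) ℕ.< p
    <p = subst (ℕ._< p) (sym (cong abs (ℤₚ.m-n≡m⊖n (toℕ i) (toℕ j))))
      (ℕₚ.≤-<-trans (ℤₚ.∣m⊝n∣≤m⊔n (toℕ i) (toℕ j)) (ℕₚ.⊔-lub (Finₚ.toℕ<n i) (Finₚ.toℕ<n j)))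
    zero-if-small : ∀ {d} → d ℕ.< p → p ∣ d → d ≡ 0
    zero-if-small {zero}  _  _  = refl
    zero-if-small {suc d} lt p∣ = contradiction p∣ (>⇒∤ lt)

  label : (Z → Bool) → Z
  label A = argmin (cost A)

  -- Rotation preserves costs, so the rotated label minimises the cost of the rotated set, and this
  -- minimiser is unique.
  label-rot : Prime p → ∀ {A B} → Nonempty A → ¬ Full A → (∀ i → B (rot i) ≡ A i) →
              label B ≡ rot (label A)
  label-rot prime-p {A} {B} (a , Aa) ¬full eq =
    argmin-unique (cost B) (cost-injective prime-p B (rot a , trans (eq a) Aa) (λ full → ¬full (λ i → trans (sym (eq i)) (full (rot i)))))
      (rot (label A)) least
    where
    least : ∀ i → cost B (rot (label A)) ≤ cost B i
    least i = subst (λ j → cost B (rot (label A)) ≤ cost B j) (rot-rot^q i)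
      (subst (λ t → t ≤ cost B (rot (rot^ q i))) (sym (cost-rot {A} {B} eq (label A)))
        (subst (λ t → cost A (label A) ≤ t) (sym (cost-rot {A} {B} eq (rot^ q i))) (argmin-≤ (cost A) (rot^ q i))))

  label-cong : Prime p → ∀ {A B} → Nonempty A → ¬ Full A → (∀ i → B i ≡ A i) → label B ≡ label A
  label-cong prime-p {A} {B} (a , Aa) ¬full eq =
    argmin-unique (cost B) (cost-injective prime-p B (a , trans (eq a) Aa) (λ full → ¬full (λ i → trans (sym (eq i)) (full i))))
      (label A) least
    where
    cost-≡ : ∀ i → cost B i ≡ cost A i
    cost-≡ i = sumᶻ-cong (λ j → cong (λ a → + bit a * diff i j) (eq j))
    least : ∀ i → cost B (label A) ≤ cost B i
    least i = subst (λ t → t ≤ cost B i) (sym (cost-≡ (label A)))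
      (subst (λ t → cost A (label A) ≤ t) (sym (cost-≡ i)) (argmin-≤ (cost A) i))

  -- Rotation fixes the full set and moves every sign, so no equivariant choice can depend on that
  -- set alone; the fallback supplies it.
  setLabel : (Z → Bool) → Maybe Z → Maybe Z
  setLabel A fallback with nonempty? A | full? A
  ... | no  _ | _     = nothing
  ... | yes _ | no  _ = just (label A)
  ... | yes _ | yes _ = fallback

  setLabel-rot : Prime p → ∀ {A B} {a b : Maybe Z} → (∀ i → B (rot i) ≡ A i) → b ≡ Maybe.map rot a →
                 setLabel B b ≡ Maybe.map rot (setLabel A a)
  setLabel-rot prime-p {A} {B} eq b≡ with nonempty? A | full? A | nonempty? B | full? B
  ... | no _   | _        | no  _        | _         = refl
  ... | no ¬ne | _        | yes (i , Bi) | _         = contradiction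
        (rot^ q i , trans (sym (eq (rot^ q i))) (trans (cong B (rot-rot^q i)) Bi)) ¬ne
  ... | yes (i , Ai) | _  | no ¬ne       | _         = contradiction (rot i , trans (eq i) Ai) ¬ne
  ... | yes ne | no ¬full | yes _        | no _      = cong just (label-rot prime-p {A} {B} ne ¬full eq)
  ... | yes _  | no ¬full | yes _        | yes full  = contradiction (λ i → trans (sym (eq i)) (full (rot i))) ¬full
  ... | yes _  | yes full | yes _        | no ¬full  = contradiction
        (λ i → trans (cong B (sym (rot-rot^q i))) (trans (eq (rot^ q i)) (full (rot^ q i)))) ¬full
  ... | yes _  | yes _    | yes _        | yes _     = b≡

  setLabel-cong : Prime p → ∀ {A B} {a b : Maybe Z} → (∀ i → B i ≡ A i) → (Full A → b ≡ a) →
                  setLabel B b ≡ setLabel A a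
  setLabel-cong prime-p {A} {B} eq b≡ with nonempty? A | full? A | nonempty? B | full? B
  ... | no _   | _        | no  _        | _         = refl
  ... | no ¬ne | _        | yes (i , Bi) | _         = contradiction (i , trans (sym (eq i)) Bi) ¬ne
  ... | yes (i , Ai) | _  | no ¬ne       | _         = contradiction (i , trans (eq i) Ai) ¬ne
  ... | yes ne | no ¬full | yes _        | no _      = cong just (label-cong prime-p {A} {B} ne ¬full eq)
  ... | yes _  | no ¬full | yes _        | yes full  = contradiction (λ i → trans (sym (eq i)) (full i)) ¬full
  ... | yes _  | yes full | yes _        | no ¬full  = contradiction (λ i → trans (eq i) (full i)) ¬full
  ... | yes _  | yes full | yes _        | yes _     = b≡ full

  setLabel-just : ∀ A {a} → Nonempty A → (Full A → ∃ λ g → a ≡ just g) → ∃ λ g → setLabel A a ≡ just g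
  setLabel-just A ne a≡ with nonempty? A | full? A
  ... | no ¬ne | _        = contradiction ne ¬ne
  ... | yes _  | no  _    = _ , refl
  ... | yes _  | yes full = a≡ full

  firstJust : ∀ {ℓ} → (Fin ℓ → Maybe Z) → Maybe Z
  firstJust {zero}  f = nothing
  firstJust {suc ℓ} f = Maybe.maybe just (firstJust (f ∘ suc)) (f zero)

  firstJust-cong : ∀ {ℓ} {f g : Fin ℓ → Maybe Z} → (∀ i → f i ≡ g i) → firstJust f ≡ firstJust g
  firstJust-cong {zero}  eq = refl
  firstJust-cong {suc ℓ} eq = cong₂ (Maybe.maybe just) (firstJust-cong (eq ∘ suc)) (eq zero)

  firstJust-map : ∀ {ℓ} (f : Fin ℓ → Maybe Z) → firstJust (Maybe.map rot ∘ f) ≡ Maybe.map rot (firstJust f)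
  firstJust-map {zero}  f = refl
  firstJust-map {suc ℓ} f with f zero
  ... | just _  = refl
  ... | nothing = firstJust-map (f ∘ suc)

  firstJust-just : ∀ {ℓ} (f : Fin ℓ → Maybe Z) i {g} → f i ≡ just g → ∃ λ h → firstJust f ≡ just h
  firstJust-just f zero    eq rewrite eq = _ , refl
  firstJust-just f (suc i) eq with f zero
  ... | just h  = h , refl
  ... | nothing = firstJust-just (f ∘ suc) i eq

-- Injections between finite sets.

injective⇒surjective : ∀ {n} (f : Fin n → Fin n) → (∀ i j → f i ≡ f j → i ≡ j) → ∀ y → ∃ λ x → f x ≡ y
injective⇒surjective {suc n} f inj y = decidable-stable (any? (λ x → f x ≟ y)) λ missed →
  contradiction
    (injective⇒≤ {f = λ x → punchOut {i = y} {f x} (λ eq → missed (x , sym eq))}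
      (λ {i} {j} eq → inj i j (punchOut-injective (λ eq → missed (i , sym eq)) (λ eq → missed (j , sym eq)) eq)))
    ℕₚ.1+n≰n

select : ∀ {ℓ} (A : Fin ℓ → Bool) k → k ℕ.≤ count A →
         ∃ λ (e : Fin k → Fin ℓ) → (∀ i j → e i ≡ e j → i ≡ j) × (∀ i → A (e i) ≡ true)
select A zero le = (λ ()) , (λ ()) , (λ ())
select {suc ℓ} A (suc k) le with A zero in A0
... | false = let e , inj , Ae = select (A ∘ suc) (suc k) le in
              suc ∘ e , (λ i j eq → inj i j (suc-injective eq)) , Ae
... | true with e , inj , Ae ← select (A ∘ suc) k (ℕ.s≤s⁻¹ le) = e′ , inj′ , Ae′
  where
  e′ : Fin (suc k) → Fin (suc ℓ)
  e′ zero    = zero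
  e′ (suc i) = suc (e i)
  inj′ : ∀ i j → e′ i ≡ e′ j → i ≡ j
  inj′ zero    zero    eq = refl
  inj′ (suc i) (suc j) eq = cong suc (inj i j (suc-injective eq))
  Ae′ : ∀ i → A (e′ i) ≡ true
  Ae′ zero    = A0
  Ae′ (suc i) = Ae i

-- Monotone equivariant families of sign sets.

module Families (q : ℕ) (prime-p : Prime (suc q)) {n ℓ : ℕ} where
  open Cyclic q
  open SignVectors q
  open SetLabel q

  -- The common form of the sets T_B(X), indexed by blocks, and U_c(X), indexed by colours.
  Family : Set
  Family = V n → Fin ℓ → Z → Bool

  Monotone Equivariantᶠ : Family → Set
  Monotone     𝒮 = ∀ Y X → Y ≼ X → ∀ B i → 𝒮 Y B i ≡ true → 𝒮 X B i ≡ true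
  Equivariantᶠ 𝒮 = ∀ X B i → 𝒮 (shift X) B (rot i) ≡ 𝒮 X B i

  weight : Family → V n → ℕ
  weight 𝒮 X = sum (λ B → count (𝒮 X B))

  weight-mono : ∀ {𝒮} → Monotone 𝒮 → ∀ Y X → Y ≼ X → weight 𝒮 Y ℕ.≤ weight 𝒮 X
  weight-mono mono Y X Y≼X = sum-mono (λ B → sum-mono (λ i → bit-mono (mono Y X Y≼X B i)))

  -- Every summand can only grow, so equal totals force equal summands. Hence a label computed from
  -- the sets is constant along steps of constant rank.
  weight-≡ : ∀ {𝒮} → Monotone 𝒮 → ∀ Y X → Y ≼ X → weight 𝒮 Y ≡ weight 𝒮 X → ∀ B i → 𝒮 Y B i ≡ 𝒮 X B i
  weight-≡ mono Y X Y≼X eq B i = bit-injective (sum-mono-≡ (λ i → bit-mono (mono Y X Y≼X B i))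
    (sum-mono-≡ (λ B → sum-mono (λ i → bit-mono (mono Y X Y≼X B i))) eq B) i)

  weight-shift : ∀ {𝒮} → Equivariantᶠ 𝒮 → ∀ X → weight 𝒮 (shift X) ≡ weight 𝒮 X
  weight-shift {𝒮} equiv X = sum-cong-≗ (λ B → count-rot {𝒮 X B} {𝒮 (shift X) B} (equiv X B))

  weight-positive : ∀ 𝒮 X B i → 𝒮 X B i ≡ true → 0 ℕ.< weight 𝒮 X
  weight-positive 𝒮 X B i eq = ℕₚ.<-≤-trans (count-positive (𝒮 X B) i eq) (term≤sum (λ B → count (𝒮 X B)) B)

  -- The shift does not move the index, so taking the first index that yields a sign preserves
  -- equivariance.
  familyLabel : Family → (V n → Fin ℓ → Maybe Z) → V n → Maybe Z
  familyLabel 𝒮 fallback X = firstJust (λ B → setLabel (𝒮 X B) (fallback X B))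

  familyLabel-shift : ∀ 𝒮 fallback → Equivariantᶠ 𝒮 →
    (∀ X B → fallback (shift X) B ≡ Maybe.map rot (fallback X B)) →
    ∀ X → familyLabel 𝒮 fallback (shift X) ≡ Maybe.map rot (familyLabel 𝒮 fallback X)
  familyLabel-shift 𝒮 fallback equiv fb X = trans
    (firstJust-cong (λ B → setLabel-rot prime-p {𝒮 X B} {𝒮 (shift X) B} (equiv X B) (fb X B)))
    (firstJust-map (λ B → setLabel (𝒮 X B) (fallback X B)))

  familyLabel-cong : ∀ 𝒮 fallback Y X → (∀ B i → 𝒮 Y B i ≡ 𝒮 X B i) →
    (∀ B → Full (𝒮 X B) → fallback Y B ≡ fallback X B) →
    familyLabel 𝒮 fallback Y ≡ familyLabel 𝒮 fallback X
  familyLabel-cong 𝒮 fallback Y X eq fb =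
    firstJust-cong (λ B → setLabel-cong prime-p {𝒮 X B} {𝒮 Y B} (eq B) (fb B))

  familyLabel-just : ∀ 𝒮 fallback X B i → 𝒮 X B i ≡ true →
    (Full (𝒮 X B) → ∃ λ g → fallback X B ≡ just g) → ∃ λ g → familyLabel 𝒮 fallback X ≡ just g
  familyLabel-just 𝒮 fallback X B i eq fb =
    firstJust-just (λ B → setLabel (𝒮 X B) (fallback X B)) B (proj₂ (setLabel-just (𝒮 X B) (i , eq) fb))

-- The lower bound for a prime, by contradiction with the Tucker lemma.

module PrimeStep (q : ℕ) (prime-p : Prime (suc q)) (1≤q : 1 ℕ.≤ q) {n ℓ m : ℕ} (k₀ : ℕ)
  (blk : Fin n → Fin ℓ) (pos : Fin n → Fin (suc q))
  (inj : ∀ x y → blk x ≡ blk y → pos x ≡ pos y → x ≡ y)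
  (lt : suc q ℕ.* (k₀ ℕ.+ m) ℕ.< n ℕ.+ m)
  (Q : Fin m → (Fin n → Bool) → Set)
  (Q? : ∀ c A → Dec (Q c A))
  (mono : ∀ c {A B} → A ⊑ B → Q c A → Q c B)
  (cover : ∀ (e : Fin (suc k₀) → Fin n) → (∀ i j → blk (e i) ≡ blk (e j) → i ≡ j) →
           ∃ λ c → Q c (image e (λ _ → true)))
  (none : ¬ ∃₂ λ c (f : Vec (Fin (suc q)) n) → ∀ i → Q c (fibre f i)) where

  open Cyclic q
  open SignVectors q
  open SetLabel q
  open Tucker q
  open Families q prime-p

  α : ℕ
  α = p ℕ.* k₀

  _≟ᴹ_ : (a b : Maybe Z) → Dec (a ≡ b)
  _≟ᴹ_ = Maybeₚ.≡-dec _≟_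

  signClass : V n → Z → Fin n → Bool
  signClass X i x = does (lookup X x ≟ᴹ just i)

  lookup-shift : ∀ (X : V n) x {i} → lookup X x ≡ just i → lookup (shift X) x ≡ just (rot i)
  lookup-shift X x eq = trans (lookup-map x _ X) (cong (Maybe.map rot) eq)

  lookup-shift⁻ : ∀ (X : V n) x {i} → lookup (shift X) x ≡ just (rot i) → lookup X x ≡ just i
  lookup-shift⁻ X x eq = Maybeₚ.map-injective rot-injective (trans (sym (lookup-map x _ X)) eq)

  T : Family {n} {ℓ}
  T X B i = does (any? (λ x → (blk x ≟ B) ×-dec (lookup X x ≟ᴹ just i)))

  T⁻ : ∀ X B i → T X B i ≡ true → ∃ λ x → blk x ≡ B × lookup X x ≡ just i
  T⁻ X B i = does⁻ (any? (λ x → (blk x ≟ B) ×-dec (lookup X x ≟ᴹ just i)))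

  T⁺ : ∀ X x {i} → lookup X x ≡ just i → T X (blk x) i ≡ true
  T⁺ X x {i} eq = dec-true (any? (λ y → (blk y ≟ blk x) ×-dec (lookup X y ≟ᴹ just i))) (x , refl , eq)

  T-mono : Monotone T
  T-mono Y X Y≼X B i eq = let x , bx , Yx = T⁻ Y B i eq in
    subst (λ B → T X B i ≡ true) bx (T⁺ X x (Y≼X x Yx))

  T-equiv : Equivariantᶠ T
  T-equiv X B i = does-⇔ (mk⇔ (λ (x , bx , eq) → x , bx , lookup-shift⁻ X x eq)
                               (λ (x , bx , eq) → x , bx , lookup-shift X x eq))
    (any? (λ x → (blk x ≟ B) ×-dec (lookup (shift X) x ≟ᴹ just (rot i))))
    (any? (λ x → (blk x ≟ B) ×-dec (lookup X x ≟ᴹ just i)))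

  U : Family {n} {m}
  U X c i = does (Q? c (signClass X i))

  U-mono : Monotone U
  U-mono Y X Y≼X c i eq = dec-true (Q? c (signClass X i))
    (mono c (λ x Yx → dec-true (lookup X x ≟ᴹ just i) (Y≼X x (does⁻ (lookup Y x ≟ᴹ just i) Yx)))
      (does⁻ (Q? c (signClass Y i)) eq))

  U-equiv : Equivariantᶠ U
  U-equiv X c i = does-⇔ (mk⇔
    (mono c (λ x eq → dec-true (lookup X x ≟ᴹ just i)
      (lookup-shift⁻ X x (does⁻ (lookup (shift X) x ≟ᴹ just (rot i)) eq))))
    (mono c (λ x eq → dec-true (lookup (shift X) x ≟ᴹ just (rot i))
      (lookup-shift X x (does⁻ (lookup X x ≟ᴹ just i) eq)))))
    (Q? c (signClass (shift X) (rot i))) (Q? c (signClass X i))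

  U-proper : ∀ X c → ¬ Full (U X c)
  U-proper X c full = none (c , tabulate f , λ i → mono c (λ x eq →
      dec-true (lookup (tabulate f) x ≟ i)
        (trans (lookup∘tabulate f x) (cong (fromMaybe zero) (does⁻ (lookup X x ≟ᴹ just i) eq))))
    (does⁻ (Q? c (signClass X i)) (full i)))
    where
    -- Zero coordinates join the class of the sign `zero`; enlarging a class is harmless because Q
    -- is monotone.
    f : Fin n → Z
    f x = fromMaybe zero (lookup X x)

  member : Fin ℓ → Maybe (Fin n)
  member B with any? (λ x → blk x ≟ B)
  ... | yes (x , _) = just x
  ... | no  _       = nothing

  -- The entry of X at one fixed point of the block: a single coordinate is equivariant by
  -- construction.
  fallbackᵀ : V n → Fin ℓ → Maybe Z
  fallbackᵀ X B = Maybe.maybe (lookup X) nothing (member B)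

  fallbackᵀ-shift : ∀ X B → fallbackᵀ (shift X) B ≡ Maybe.map rot (fallbackᵀ X B)
  fallbackᵀ-shift X B with member B
  ... | just x  = lookup-map x _ X
  ... | nothing = refl

  -- A block has at most p elements, so X takes every value on it only if X is nonzero on it.
  fallbackᵀ-just : ∀ X B → Full (T X B) → ∃ λ g → fallbackᵀ X B ≡ just g
  fallbackᵀ-just X B full with any? (λ x → blk x ≟ B)
  ... | no  none       = contradiction (let x , bx , _ = T⁻ X B zero (full zero) in x , bx) none
  ... | yes (x₀ , bx₀) = i , trans (cong (lookup X) (sym y≡x₀)) (Xy i)
    where
    y : Z → Fin n
    y i = proj₁ (T⁻ X B i (full i))
    blk-y : ∀ i → blk (y i) ≡ B
    blk-y i = proj₁ (proj₂ (T⁻ X B i (full i)))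
    Xy : ∀ i → lookup X (y i) ≡ just i
    Xy i = proj₂ (proj₂ (T⁻ X B i (full i)))
    y-inj : ∀ i j → pos (y i) ≡ pos (y j) → i ≡ j
    y-inj i j eq = Maybeₚ.just-injective (trans (sym (Xy i)) (trans
      (cong (lookup X) (inj (y i) (y j) (trans (blk-y i) (sym (blk-y j))) eq)) (Xy j)))
    hit : ∃ λ i → pos (y i) ≡ pos x₀
    hit = injective⇒surjective (pos ∘ y) y-inj (pos x₀)
    i : Z
    i = proj₁ hit
    y≡x₀ : y i ≡ x₀
    y≡x₀ = inj (y i) x₀ (trans (blk-y i) (sym bx₀)) (proj₂ hit)

  -- Fullness makes Y nonzero at the fixed point, and X agrees with Y wherever Y is nonzero.
  fallbackᵀ-≼ : ∀ Y X → Y ≼ X → ∀ B → Full (T Y B) → fallbackᵀ Y B ≡ fallbackᵀ X B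
  fallbackᵀ-≼ Y X Y≼X B full = trans (proj₂ fbY) (sym (lift (proj₂ fbY)))
    where
    fbY : ∃ λ g → fallbackᵀ Y B ≡ just g
    fbY = fallbackᵀ-just Y B full
    lift : ∀ {g} → fallbackᵀ Y B ≡ just g → fallbackᵀ X B ≡ just g
    lift eq with member B
    ... | just x = Y≼X x eq

  labelᵀ labelᵁ : V n → Maybe Z
  labelᵀ = familyLabel T fallbackᵀ
  labelᵁ = familyLabel U (λ _ _ → nothing)

  labelᵀ-just : ∀ X → Nonzero X → ∃ λ g → labelᵀ X ≡ just g
  labelᵀ-just X (x , i , eq) = familyLabel-just T fallbackᵀ X (blk x) i (T⁺ X x eq) (fallbackᵀ-just X (blk x))

  -- Pigeonhole over the p signs, after exchanging the sums over blocks and signs.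
  some-sign-hits-many-blocks : ∀ X → α ℕ.< weight T X → ∃ λ i → k₀ ℕ.< count (λ B → T X B i)
  some-sign-hits-many-blocks X big = decidable-stable (any? (λ i → k₀ ℕ.<? count (λ B → T X B i))) λ few →
    contradiction
      (begin
        weight T X                          ≡⟨ ∑-comm (λ B i → bit (T X B i)) ⟩
        sum (λ i → count (λ B → T X B i))   ≤⟨ sum-mono (λ i → ℕₚ.≮⇒≥ (λ more → few (i , more))) ⟩
        sum {p} (λ i → k₀)                  ≡⟨ sum-const p k₀ ⟩
        α                                   ∎)
      (ℕₚ.<⇒≱ big)
    where open ℕₚ.≤-Reasoning

  -- One point of sign i from each of k₀ + 1 blocks gives an admissible set, and `cover` provides
  -- its colour.
  U-nonempty : ∀ X → α ℕ.< weight T X → ∃₂ λ c i → U X c i ≡ true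
  U-nonempty X big = c , i , dec-true (Q? c (signClass X i)) (mono c image⊑ (proj₂ covered))
    where
    i : Z
    i = proj₁ (some-sign-hits-many-blocks X big)
    selected : ∃ λ (e : Fin (suc k₀) → Fin ℓ) → (∀ s t → e s ≡ e t → s ≡ t) × (∀ s → T X (e s) i ≡ true)
    selected = select (λ B → T X B i) (suc k₀) (proj₂ (some-sign-hits-many-blocks X big))
    e : Fin (suc k₀) → Fin ℓ
    e = proj₁ selected
    x : ∀ s → ∃ λ x → blk x ≡ e s × lookup X x ≡ just i
    x s = T⁻ X (e s) i (proj₂ (proj₂ selected) s)
    covered : ∃ λ c → Q c (image (λ s → proj₁ (x s)) (λ _ → true))
    covered = cover (λ s → proj₁ (x s)) (λ s t eq → proj₁ (proj₂ selected) s t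
      (trans (sym (proj₁ (proj₂ (x s)))) (trans eq (proj₁ (proj₂ (x t))))))
    c : Fin m
    c = proj₁ covered
    image⊑ : image (λ s → proj₁ (x s)) (λ _ → true) ⊑ signClass X i
    image⊑ y y∈ = let s , _ , eq = ∈-image⁻ (λ s → proj₁ (x s)) (λ _ → true) y y∈ in
      dec-true (lookup X y ≟ᴹ just i) (subst (λ z → lookup X z ≡ just i) eq (proj₂ (proj₂ (x s))))

  labelᵁ-just : ∀ X → α ℕ.< weight T X → ∃ λ g → labelᵁ X ≡ just g
  labelᵁ-just X big = let c , i , eq = U-nonempty X big in
    familyLabel-just U (λ _ _ → nothing) X c i eq (λ full → contradiction full (U-proper X c))

  weightᵁ-positive : ∀ X → α ℕ.< weight T X → 0 ℕ.< weight U X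
  weightᵁ-positive X big = let c , i , eq = U-nonempty X big in weight-positive U X c i eq

  -- The default `zero` is reached only at the zero vector, by `labelᵀ-just` and `labelᵁ-just`.
  lab : V n → Z
  lab X with weight T X ℕ.≤? α
  ... | yes _ = fromMaybe zero (labelᵀ X)
  ... | no  _ = fromMaybe zero (labelᵁ X)

  ρ : V n → ℕ
  ρ X with weight T X ℕ.≤? α
  ... | yes _ = weight T X
  ... | no  _ = α ℕ.+ weight U X

  fromMaybe-map : ∀ {a : Maybe Z} {g} → a ≡ just g → fromMaybe zero (Maybe.map rot a) ≡ rot (fromMaybe zero a)
  fromMaybe-map refl = refl

  lab-equivariant : Equivariant lab
  lab-equivariant X nz with weight T (shift X) ℕ.≤? α | weight T X ℕ.≤? α
  ... | yes _  | yes _  = trans (cong (fromMaybe zero) (familyLabel-shift T fallbackᵀ T-equiv fallbackᵀ-shift X))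
                            (fromMaybe-map (proj₂ (labelᵀ-just X nz)))
  ... | no  _  | no big = trans (cong (fromMaybe zero) (familyLabel-shift U (λ _ _ → nothing) U-equiv (λ _ _ → refl) X))
                            (fromMaybe-map (proj₂ (labelᵁ-just X (ℕₚ.≰⇒> big))))
  ... | yes le | no ¬le = contradiction (subst (ℕ._≤ α) (weight-shift {𝒮 = T} T-equiv X) le) ¬le
  ... | no ¬le | yes le = contradiction (subst (ℕ._≤ α) (sym (weight-shift {𝒮 = T} T-equiv X)) le) ¬le

  ρ-mono : ∀ Y X → Y ≼ X → ρ Y ℕ.≤ ρ X
  ρ-mono Y X Y≼X with weight T Y ℕ.≤? α | weight T X ℕ.≤? α
  ... | yes _  | yes _  = weight-mono {𝒮 = T} T-mono Y X Y≼X
  ... | yes le | no  _  = ℕₚ.≤-trans le (ℕₚ.m≤m+n α _)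
  ... | no  _  | no  _  = ℕₚ.+-monoʳ-≤ α (weight-mono {𝒮 = U} U-mono Y X Y≼X)
  ... | no ¬le | yes le = contradiction (ℕₚ.≤-trans (weight-mono {𝒮 = T} T-mono Y X Y≼X) le) ¬le

  ρ-same : ∀ Y X → Y ≼ X → ρ Y ≡ ρ X → lab Y ≡ lab X
  ρ-same Y X Y≼X eq with weight T Y ℕ.≤? α | weight T X ℕ.≤? α
  ... | yes _  | yes _  = cong (fromMaybe zero) (familyLabel-cong T fallbackᵀ Y X (weight-≡ {𝒮 = T} T-mono Y X Y≼X eq)
        (λ B full → fallbackᵀ-≼ Y X Y≼X B (λ i → trans (weight-≡ {𝒮 = T} T-mono Y X Y≼X eq B i) (full i))))
  ... | no  _  | no  _  = cong (fromMaybe zero) (familyLabel-cong U (λ _ _ → nothing) Y X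
        (weight-≡ {𝒮 = U} U-mono Y X Y≼X (ℕₚ.+-cancelˡ-≡ α _ _ eq)) (λ _ _ → refl))
  -- A step across the threshold raises the rank from at most α to above α, because some U_c(X) is
  -- nonempty.
  ... | yes le | no big = contradiction
        (ℕₚ.<-≤-trans (ℕₚ.m<m+n α (weightᵁ-positive X (ℕₚ.≰⇒> big))) (subst (ℕ._≤ α) eq le)) (ℕₚ.<-irrefl refl)
  ... | no ¬le | yes le = contradiction (ℕₚ.≤-trans (weight-mono {𝒮 = T} T-mono Y X Y≼X) le) ¬le

  ρ-positive : ∀ X → Nonzero X → 0 ℕ.< ρ X
  ρ-positive X (x , i , eq) with weight T X ℕ.≤? α
  ... | yes _  = weight-positive T X (blk x) i (T⁺ X x eq)
  ... | no big = ℕₚ.<-≤-trans (weightᵁ-positive X (ℕₚ.≰⇒> big)) (ℕₚ.m≤n+m _ α)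

  ρ-bound : ∀ X → ρ X ℕ.< n
  ρ-bound X = ℕₚ.+-cancelʳ-< m (ρ X) n (ℕₚ.≤-<-trans below lt)
    where
    open ℕₚ.≤-Reasoning
    below : ρ X ℕ.+ m ℕ.≤ p ℕ.* (k₀ ℕ.+ m)
    below with weight T X ℕ.≤? α
    ... | yes le = begin
          weight T X ℕ.+ m    ≤⟨ ℕₚ.+-mono-≤ le (ℕₚ.m≤n*m m p) ⟩
          α ℕ.+ p ℕ.* m       ≡⟨ sym (ℕₚ.*-distribˡ-+ p k₀ m) ⟩
          p ℕ.* (k₀ ℕ.+ m)    ∎
    ... | no  _  = begin
          (α ℕ.+ weight U X) ℕ.+ m               ≡⟨ ℕₚ.+-assoc α (weight U X) m ⟩
          -- The added m gives one unit to each colour, and a proper subset of ℤ/p plus one counts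
          -- at most p.
          α ℕ.+ (weight U X ℕ.+ m)               ≡⟨ cong (α ℕ.+_) (sum-suc (λ c → count (U X c))) ⟩
          α ℕ.+ sum (λ c → suc (count (U X c)))  ≤⟨ ℕₚ.+-monoʳ-≤ α (sum-mono (λ c → count<p (U X c) (U-proper X c))) ⟩
          α ℕ.+ sum {m} (λ c → p)                ≡⟨ cong (α ℕ.+_) (trans (sum-const m p) (ℕₚ.*-comm m p)) ⟩
          α ℕ.+ p ℕ.* m                          ≡⟨ sym (ℕₚ.*-distribˡ-+ p k₀ m) ⟩
          p ℕ.* (k₀ ℕ.+ m)                       ∎

  impossible : ⊥
  impossible = tucker 1≤q n lab lab-equivariant ρ ρ-mono ρ-same ρ-positive ρ-bound

-- From primes to all r, and the comparison of b(r) with r.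

lowerBound-prime : ∀ {p} → Prime p → LowerBound p
lowerBound-prime {zero}        prime-p = contradiction prime-p ¬prime[0]
lowerBound-prime {suc zero}    prime-p = contradiction prime-p ¬prime[1]
lowerBound-prime {suc (suc q)} prime-p k₀ blk pos inj lt Q Q? mono cover =
  -- `PrimeStep` refutes the absence of a solution; finite search turns this into an actual
  -- solution.
  decidable-stable (any? (λ c → ∃Vec? (λ f → all? (λ i → Q? c (fibre f i)))))
    (PrimeStep.impossible (suc q) prime-p (s≤s z≤n) k₀ blk pos inj lt Q Q? mono cover)

lowerBound-product : ∀ {ps} → All Prime ps → LowerBound (product ps)
lowerBound-product All.[]             = lowerBound-1
lowerBound-product (prime-p All.∷ ps) =
  lowerBound-* (ℕₚ.n≢0⇒n>0 (λ { refl → ¬prime[0] prime-p })) (lowerBound-prime prime-p) (lowerBound-product ps)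

lowerBound : ∀ r .{{_ : ℕ.NonZero r}} → LowerBound r
lowerBound r = subst LowerBound (sym (PrimeFactorisation.isFactorisation (factorise r)))
  (lowerBound-product (PrimeFactorisation.factorsPrime (factorise r)))

bFactor≤ : ∀ p → bFactor p ℕ.≤ p
bFactor≤ p with p ℕ.≟ 2
... | yes refl = ℕₚ.≤-refl
... | no  _    = ℕₚ.m∸n≤m p 1

product-bFactor≤ : ∀ ps → product (List.map bFactor ps) ℕ.≤ product ps
product-bFactor≤ List.[]       = ℕₚ.≤-refl
product-bFactor≤ (p List.∷ ps) = ℕₚ.*-mono-≤ (bFactor≤ p) (product-bFactor≤ ps)

b≤ : ∀ r → b r ℕ.≤ r
b≤ zero    = z≤n
b≤ (suc r) = ℕₚ.≤-trans (product-bFactor≤ (factors (factorise (suc r))))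
  (ℕₚ.≤-reflexive (sym (PrimeFactorisation.isFactorisation (factorise (suc r)))))

-- Subsets, blocks and the lower bound for the Kneser hypergraph.

∣∣≡count : ∀ {n} (σ : Subset n) → ∣ σ ∣ ≡ count (lookup σ)
∣∣≡count []          = refl
∣∣≡count (true ∷ σ)  = cong suc (∣∣≡count σ)
∣∣≡count (false ∷ σ) = ∣∣≡count σ

-- The position of x in the increasing enumeration of A; inside a block it serves as `pos`.
rank : ∀ {n} → (Fin n → Bool) → Fin n → ℕ
rank A zero    = 0
rank A (suc x) = bit (A zero) ℕ.+ rank (A ∘ suc) x

rank< : ∀ {n} (A : Fin n → Bool) x → A x ≡ true → rank A x ℕ.< count A
rank< A zero    Ax rewrite Ax = s≤s z≤n
rank< A (suc x) Ax = ℕₚ.+-monoʳ-< (bit (A zero)) (rank< (A ∘ suc) x Ax)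

rank-injective : ∀ {n} (A : Fin n → Bool) x y → A x ≡ true → A y ≡ true → rank A x ≡ rank A y → x ≡ y
rank-injective A zero    zero    _  _  _  = refl
rank-injective A zero    (suc y) Ax _  eq rewrite Ax = contradiction eq λ ()
rank-injective A (suc x) zero    _  Ay eq rewrite Ay = contradiction eq λ ()
rank-injective A (suc x) (suc y) Ax Ay eq =
  cong suc (rank-injective (A ∘ suc) x y Ax Ay (ℕₚ.+-cancelˡ-≡ (bit (A zero)) _ _ eq))

≤count : ∀ {n k} (A : Fin n → Bool) (e : Fin k → Fin n) → (∀ i j → e i ≡ e j → i ≡ j) →
         (∀ i → A (e i) ≡ true) → k ℕ.≤ count A
≤count A e inj Ae = injective⇒≤ {f = λ i → fromℕ< (rank< A (e i) (Ae i))}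
  (λ {i} {j} eq → inj i j (rank-injective A (e i) (e j) (Ae i) (Ae j)
    (Finₚ.fromℕ<-injective _ _ (rank< A (e i) (Ae i)) (rank< A (e j) (Ae j)) eq)))

count≤ : ∀ {n k} (A : Fin n → Bool) (f : ∀ x → A x ≡ true → Fin k) →
         (∀ x y Ax Ay → f x Ax ≡ f y Ay → x ≡ y) → count A ℕ.≤ k
count≤ A f inj = let e , e-inj , Ae = select A (count A) ℕₚ.≤-refl in
  injective⇒≤ {f = λ i → f (e i) (Ae i)} (λ {i} {j} eq → e-inj i j (inj (e i) (e j) (Ae i) (Ae j) eq))

∈⇒lookup : ∀ {n} {σ : Subset n} {x} → x ∈ σ → lookup σ x ≡ true
∈⇒lookup = []=⇒lookup

lookup⇒∈ : ∀ {n} {σ : Subset n} {x} → lookup σ x ≡ true → x ∈ σ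
lookup⇒∈ {σ = σ} {x} = lookup⇒[]= x σ

lookup-block : ∀ {n} (P : Partition n) i x → lookup (block P i) x ≡ true → blk P x ≡ i
lookup-block P i x eq with blk P x ≟ i | trans (sym (lookup∘tabulate _ x)) eq
... | yes p | _  = p
... | no  _ | ()

lookup-block⁺ : ∀ {n} (P : Partition n) x → lookup (block P (blk P x)) x ≡ true
lookup-block⁺ P x with blk P x ≟ blk P x | lookup∘tabulate-block
  where
  lookup∘tabulate-block : lookup (block P (blk P x)) x ≡ _
  lookup∘tabulate-block = lookup∘tabulate _ x
... | yes _ | eq = eq
... | no ne | _  = contradiction refl ne

vertex? : ∀ {n} k (P : Partition n) σ → Dec (IsVertex k P σ)
vertex? k P σ = (∣ σ ∣ ℕ.≟ k) ×-dec all? (λ i → ∣ σ ∩ block P i ∣ ℕ.≤? 1)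

transversal-vertex : ∀ {n k} (P : Partition n) (e : Fin k → Fin n) →
                     (∀ i j → blk P (e i) ≡ blk P (e j) → i ≡ j) →
                     IsVertex k P (tabulate (image e (λ _ → true)))
transversal-vertex {n} {k} P e inj = size , meets
  where
  σ : Subset n
  σ = tabulate (image e (λ _ → true))
  preimage : ∀ x → lookup σ x ≡ true → ∃ λ i → e i ≡ x
  preimage x x∈ = let i , _ , eq = ∈-image⁻ e (λ _ → true) x (trans (sym (lookup∘tabulate _ x)) x∈) in i , eq
  size : ∣ σ ∣ ≡ k
  size = trans (∣∣≡count σ) (ℕₚ.≤-antisym
    (count≤ (lookup σ) (λ x x∈ → proj₁ (preimage x x∈))
      (λ x y x∈ y∈ eq → trans (sym (proj₂ (preimage x x∈))) (trans (cong e eq) (proj₂ (preimage y y∈)))))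
    (≤count (lookup σ) e (λ i j eq → inj i j (cong (blk P) eq))
      (λ i → trans (lookup∘tabulate _ (e i)) (∈-image e (λ _ → true) refl))))
  meets : ∀ B → ∣ σ ∩ block P B ∣ ℕ.≤ 1
  meets B = ℕₚ.≤-trans (ℕₚ.≤-reflexive (∣∣≡count (σ ∩ block P B))) (count≤ (lookup (σ ∩ block P B)) (λ _ _ → zero) single)
    where
    single : ∀ x y → lookup (σ ∩ block P B) x ≡ true → lookup (σ ∩ block P B) y ≡ true →
             zero {0} ≡ zero → x ≡ y
    single x y x∈ y∈ _ =
      let x∈σ , x∈B = x∈p∩q⁻ σ (block P B) (lookup⇒∈ x∈)
          y∈σ , y∈B = x∈p∩q⁻ σ (block P B) (lookup⇒∈ y∈)
          i , ei = preimage x (∈⇒lookup x∈σ)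
          j , ej = preimage y (∈⇒lookup y∈σ)
          i≡j = inj i j (trans (cong (blk P) ei) (trans (lookup-block P B x (∈⇒lookup x∈B))
                  (sym (trans (cong (blk P) ej) (lookup-block P B y (∈⇒lookup y∈B))))))
      in trans (sym ei) (trans (cong e i≡j) ej)

-- `lowerBound` is applied with Q c A saying that A contains a vertex of colour c. Such vertices in
-- the r fibres of one map are disjoint and form a monochromatic hyperedge.
not-colourable : ∀ r .{{_ : ℕ.NonZero r}} {n} k₀ (P : Partition n) →
                 (∀ i → ∣ block P i ∣ ℕ.≤ r) → ∀ m → r ℕ.* (k₀ ℕ.+ m) ℕ.< n ℕ.+ m →
                 ¬ Colorable r (suc k₀) P m
not-colourable r {n} k₀ P blocks≤r m lt (colour , proper) =
  monochromatic (lowerBound r k₀ (blk P) pos pos-injective lt Q Q? Q-mono Q-cover)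
  where
  rankInBlock : Fin n → ℕ
  rankInBlock x = rank (lookup (block P (blk P x))) x
  rank<r : ∀ x → rankInBlock x ℕ.< r
  rank<r x = ℕₚ.<-≤-trans (rank< (lookup (block P (blk P x))) x (lookup-block⁺ P x))
    (ℕₚ.≤-trans (ℕₚ.≤-reflexive (sym (∣∣≡count (block P (blk P x))))) (blocks≤r (blk P x)))
  pos : Fin n → Fin r
  pos x = fromℕ< (rank<r x)
  pos-injective : ∀ x y → blk P x ≡ blk P y → pos x ≡ pos y → x ≡ y
  pos-injective x y blk≡ pos≡ = rank-injective (lookup (block P (blk P x))) x y (lookup-block⁺ P x)
    (subst (λ B → lookup (block P B) y ≡ true) (sym blk≡) (lookup-block⁺ P y))
    (trans (Finₚ.fromℕ<-injective _ _ (rank<r x) (rank<r y) pos≡)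
      (cong (λ B → rank (lookup (block P B)) y) (sym blk≡)))

  -- The given colouring may depend on the proof that σ is a vertex; fix one proof for each σ.
  colour′ : Subset n → Maybe (Fin m)
  colour′ σ with vertex? (suc k₀) P σ
  ... | yes v = just (colour σ v)
  ... | no  _ = nothing

  colour′-vertex : ∀ σ → IsVertex (suc k₀) P σ → ∃ λ c → colour′ σ ≡ just c
  colour′-vertex σ v with vertex? (suc k₀) P σ
  ... | yes v′ = colour σ v′ , refl
  ... | no ¬v  = contradiction v ¬v

  colour′⁻ : ∀ σ c → colour′ σ ≡ just c → ∃ λ v → colour σ v ≡ c
  colour′⁻ σ c eq with vertex? (suc k₀) P σ
  colour′⁻ σ c refl | yes v = v , refl

  Q : Fin m → (Fin n → Bool) → Set
  Q c A = ∃ λ σ → (∀ x → x ∈ σ → A x ≡ true) × colour′ σ ≡ just c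

  Q? : ∀ c A → Dec (Q c A)
  Q? c A = anySubset? (λ σ → all? (λ x → (x ∈? σ) →-dec (A x ≟ᵇ true)) ×-dec Maybeₚ.≡-dec _≟_ (colour′ σ) (just c))

  Q-mono : ∀ c {A B} → A ⊑ B → Q c A → Q c B
  Q-mono c A⊑B (σ , σ⊑A , eq) = σ , (λ x x∈ → A⊑B x (σ⊑A x x∈)) , eq

  Q-cover : ∀ (e : Fin (suc k₀) → Fin n) → (∀ i j → blk P (e i) ≡ blk P (e j) → i ≡ j) →
            ∃ λ c → Q c (image e (λ _ → true))
  Q-cover e inj = let c , eq = colour′-vertex _ (transversal-vertex P e inj) in
    c , tabulate (image e (λ _ → true)) , (λ x x∈ → trans (sym (lookup∘tabulate _ x)) (∈⇒lookup x∈)) , eq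

  monochromatic : ¬ ∃₂ λ c (f : Vec (Fin r) n) → ∀ i → Q c (fibre f i)
  monochromatic (c , f , h) = proper σ (vertex , disjoint)
    (λ i j → trans (proj₂ (colour′⁻ (σ i) c (proj₂ (proj₂ (h i))))) (sym (proj₂ (colour′⁻ (σ j) c (proj₂ (proj₂ (h j)))))))
    where
    σ : Fin r → Subset n
    σ i = proj₁ (h i)
    vertex : ∀ i → IsVertex (suc k₀) P (σ i)
    vertex i = proj₁ (colour′⁻ (σ i) c (proj₂ (proj₂ (h i))))
    class : ∀ i x → x ∈ σ i → lookup f x ≡ i
    class i x x∈ = does⁻ (lookup f x ≟ i) (proj₁ (proj₂ (h i)) x x∈)
    disjoint : ∀ i j → i ≢ j → Empty (σ i ∩ σ j)
    disjoint i j i≢j (x , x∈) = let x∈i , x∈j = x∈p∩q⁻ (σ i) (σ j) x∈ in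
      i≢j (trans (sym (class i x x∈i)) (class j x x∈j))

-- The upper bound: an explicit colouring.

disjoint⇒≡ : ∀ {n r} (σ : Fin r → Subset n) → (∀ i j → i ≢ j → Empty (σ i ∩ σ j)) →
             ∀ {i j x} → x ∈ σ i → x ∈ σ j → i ≡ j
disjoint⇒≡ σ disjoint {i} {j} {x} x∈i x∈j = decidable-stable (i ≟ j)
  (λ i≢j → disjoint i j i≢j (x , x∈p∩q⁺ (x∈i , x∈j)))

-- The first N colours are intervals of r − 1 points, and r disjoint sets cannot all meet the same
-- one; the last colour is for subsets of the remaining, fewer than r · k, points.
colourable : ∀ d {n} k (P : Partition n) N → n ℕ.< N ℕ.* suc d ℕ.+ suc (suc d) ℕ.* suc k →
             Colorable (suc (suc d)) (suc k) P (suc N)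
colourable d {n} k P N n< = (λ σ _ → colour σ) , proper
  where
  interval : Fin n → ℕ
  interval x = toℕ x ℕ./ suc d

  early? : ∀ σ → Dec (∃ λ x → x ∈ σ × interval x ℕ.< N)
  early? σ = any? (λ x → (x ∈? σ) ×-dec (interval x ℕ.<? N))

  colour : Subset n → Fin (suc N)
  colour σ with early? σ
  ... | yes (_ , _ , lt) = inject₁ (fromℕ< lt)
  ... | no  _            = fromℕ N

  early : ∀ σ → toℕ (colour σ) ℕ.< N → ∃ λ x → x ∈ σ × interval x ≡ toℕ (colour σ)
  early σ lt with early? σ
  ... | yes (x , x∈ , x<) = x , x∈ , sym (trans (Finₚ.toℕ-inject₁ (fromℕ< x<)) (Finₚ.toℕ-fromℕ< x<))
  ... | no  _             = contradiction lt (ℕₚ.<-irrefl (Finₚ.toℕ-fromℕ N))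

  late : ∀ σ → ¬ toℕ (colour σ) ℕ.< N → ∀ x → x ∈ σ → N ℕ.≤ interval x
  late σ ≮N x x∈ with early? σ
  ... | yes (y , y∈ , y<) = contradiction
        (subst (ℕ._< N) (sym (trans (Finₚ.toℕ-inject₁ (fromℕ< y<)) (Finₚ.toℕ-fromℕ< y<))) y<) ≮N
  ... | no none = ℕₚ.≮⇒≥ (λ x< → none (x , x∈ , x<))

  proper : IsColoring (suc (suc d)) (suc k) P (suc N) (λ σ _ → colour σ)
  proper σ (vertex , disjoint) same with toℕ (colour (σ zero)) ℕ.<? N
  -- All d + 2 sets meet the same interval of d + 1 points, so two of them pick points with equal
  -- residues, hence the same point.
  ... | yes lt = let i , j , i<j , eq = pigeonhole (ℕₚ.n<1+n (suc d)) residue in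
      Finₚ.<⇒≢ i<j (disjoint⇒≡ σ disjoint (proj₁ (proj₂ (x i)))
        (subst (_∈ σ j) (sym (point-unique i j eq)) (proj₁ (proj₂ (x j)))))
    where
    x : ∀ i → ∃ λ x → x ∈ σ i × interval x ≡ toℕ (colour (σ i))
    x i = early (σ i) (subst (λ c → toℕ c ℕ.< N) (same zero i) lt)
    residue : Fin (suc (suc d)) → Fin (suc d)
    residue i = toℕ (proj₁ (x i)) mod suc d
    point-unique : ∀ i j → residue i ≡ residue j → proj₁ (x i) ≡ proj₁ (x j)
    point-unique i j eq = Finₚ.toℕ-injective (begin
      a                                           ≡⟨ m≡m%n+[m/n]*n a (suc d) ⟩
      a ℕ.% suc d ℕ.+ (a ℕ./ suc d) ℕ.* suc d     ≡⟨ cong₂ (λ s t → s ℕ.+ t ℕ.* suc d) remainders quotients ⟩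
      a′ ℕ.% suc d ℕ.+ (a′ ℕ./ suc d) ℕ.* suc d   ≡⟨ sym (m≡m%n+[m/n]*n a′ (suc d)) ⟩
      a′                                          ∎)
      where
      open ≡-Reasoning
      a a′ : ℕ
      a = toℕ (proj₁ (x i))
      a′ = toℕ (proj₁ (x j))
      remainders : a ℕ.% suc d ≡ a′ ℕ.% suc d
      remainders = Finₚ.fromℕ<-injective _ _ (m%n<n a (suc d)) (m%n<n a′ (suc d)) eq
      quotients : a ℕ./ suc d ≡ a′ ℕ./ suc d
      quotients = trans (proj₂ (proj₂ (x i))) (trans (cong toℕ (same i j)) (sym (proj₂ (proj₂ (x j)))))
  -- All sets avoid the first N intervals, so their (d + 2)(k + 1) distinct points would inject into
  -- the fewer remaining ones.
  ... | no ≮N = contradiction (injective⇒≤ {f = place} (λ {s} {t} → place-injective s t))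
      (ℕₚ.<⇒≱ (ℕₚ.m<n+o⇒m∸n<o n (N ℕ.* suc d) n<))
    where
    K : ℕ
    K = suc (suc d) ℕ.* suc k
    enumerate : ∀ i → ∃ λ (e : Fin (suc k) → Fin n) → (∀ s t → e s ≡ e t → s ≡ t) × (∀ s → lookup (σ i) (e s) ≡ true)
    enumerate i = select (lookup (σ i)) (suc k) (ℕₚ.≤-reflexive (trans (sym (proj₁ (vertex i))) (∣∣≡count (σ i))))
    hi : Fin K → Fin (suc (suc d))
    hi t = proj₁ (remQuot {suc (suc d)} (suc k) t)
    lo : Fin K → Fin (suc k)
    lo t = proj₂ (remQuot {suc (suc d)} (suc k) t)
    pt : Fin K → Fin n
    pt t = proj₁ (enumerate (hi t)) (lo t)
    pt∈ : ∀ t → pt t ∈ σ (hi t)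
    pt∈ t = lookup⇒∈ (proj₂ (proj₂ (enumerate (hi t))) (lo t))
    pt≥ : ∀ t → N ℕ.* suc d ℕ.≤ toℕ (pt t)
    pt≥ t = begin
      N ℕ.* suc d                                         ≤⟨ ℕₚ.*-monoˡ-≤ (suc d) (late (σ (hi t)) ≮N′ (pt t) (pt∈ t)) ⟩
      interval (pt t) ℕ.* suc d                           ≤⟨ ℕₚ.m≤n+m _ _ ⟩
      toℕ (pt t) ℕ.% suc d ℕ.+ interval (pt t) ℕ.* suc d  ≡⟨ sym (m≡m%n+[m/n]*n (toℕ (pt t)) (suc d)) ⟩
      toℕ (pt t)                                          ∎
      where
      open ℕₚ.≤-Reasoning
      ≮N′ : ¬ toℕ (colour (σ (hi t))) ℕ.< N
      ≮N′ = subst (λ c → ¬ toℕ c ℕ.< N) (same zero (hi t)) ≮N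
    pt∸< : ∀ t → toℕ (pt t) ℕ.∸ N ℕ.* suc d ℕ.< n ℕ.∸ N ℕ.* suc d
    pt∸< t = ℕₚ.∸-monoˡ-< (Finₚ.toℕ<n (pt t)) (pt≥ t)
    place : Fin K → Fin (n ℕ.∸ N ℕ.* suc d)
    place t = fromℕ< (pt∸< t)
    place-injective : ∀ s t → place s ≡ place t → s ≡ t
    place-injective s t eq = begin
      s                       ≡⟨ sym (Finₚ.combine-remQuot {suc (suc d)} (suc k) s) ⟩
      combine (hi s) (lo s)   ≡⟨ cong₂ combine hi≡ lo≡ ⟩
      combine (hi t) (lo t)   ≡⟨ Finₚ.combine-remQuot {suc (suc d)} (suc k) t ⟩
      t                       ∎
      where
      open ≡-Reasoning
      pt≡ : pt s ≡ pt t
      pt≡ = Finₚ.toℕ-injective (ℕₚ.∸-cancelʳ-≡ (pt≥ s) (pt≥ t)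
        (Finₚ.fromℕ<-injective _ _ (pt∸< s) (pt∸< t) eq))
      hi≡ : hi s ≡ hi t
      hi≡ = disjoint⇒≡ σ disjoint (pt∈ s) (subst (_∈ σ (hi t)) (sym pt≡) (pt∈ t))
      lo≡ : lo s ≡ lo t
      lo≡ = proj₁ (proj₂ (enumerate (hi t))) (lo s) (lo t)
        (trans (cong (λ i → proj₁ (enumerate i) (lo s)) (sym hi≡)) pt≡)

-- Ceilings and the chromatic number.

≤ceilDiv* : ∀ a d → a ℕ.≤ ceilDiv a (suc d) ℕ.* suc d
≤ceilDiv* a d = ℕₚ.+-cancelˡ-≤ d a _ (begin
  d ℕ.+ a                                                        ≡⟨ ℕₚ.+-comm d a ⟩
  a ℕ.+ d                                                        ≡⟨ m≡m%n+[m/n]*n (a ℕ.+ d) (suc d) ⟩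
  (a ℕ.+ d) ℕ.% suc d ℕ.+ ceilDiv a (suc d) ℕ.* suc d            ≤⟨ ℕₚ.+-monoˡ-≤ _ (ℕ.s≤s⁻¹ (m%n<n (a ℕ.+ d) (suc d))) ⟩
  d ℕ.+ ceilDiv a (suc d) ℕ.* suc d                              ∎)
  where open ℕₚ.≤-Reasoning

ceilDiv≤ : ∀ a d m → a ℕ.≤ m ℕ.* suc d → ceilDiv a (suc d) ℕ.≤ m
ceilDiv≤ a d m a≤ = ℕ.s≤s⁻¹ (m<n*o⇒m/o<n {a ℕ.+ d} {suc m} {suc d} (begin-strict
  a ℕ.+ d                  ≡⟨ ℕₚ.+-comm a d ⟩
  d ℕ.+ a                  <⟨ s≤s (ℕₚ.+-monoʳ-≤ d a≤) ⟩
  suc d ℕ.+ m ℕ.* suc d    ∎))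
  where open ℕₚ.≤-Reasoning

open import Data.Nat using (_*_; _∸_; _≤_)

theorem3p6 : ∀ (r : ℕ) → 2 ≤ r →
    ∀ (k n : ℕ) → 1 ≤ k → r * k ≤ n →
    ∀ (P : Partition n) →
    (∀ (i : Fin (ℓ P)) → ∣ block P i ∣ ≤ b r) →
    ChromaticNumberIs r k P (ceilDiv (n ∸ r * (k ∸ 1)) (r ∸ 1))
theorem3p6 (suc zero) (s≤s ()) k n 1≤k rk≤n P blocks≤
theorem3p6 r@(suc (suc d)) 2≤r (suc k₀) n 1≤k rk≤n P blocks≤ = upper , lower
  where
  a N : ℕ
  a = n ∸ r * k₀
  N = ceilDiv a (suc d)

  rk₀<n : r * k₀ ℕ.< n
  rk₀<n = ℕₚ.<-≤-trans (ℕₚ.*-monoʳ-< r (ℕₚ.n<1+n k₀)) rk≤n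

  -- Positivity lets one of the N colours be reserved for the points after the intervals.
  0<N : 0 ℕ.< N
  0<N = ℕₚ.n≢0⇒n>0 λ N≡0 → contradiction
    (ℕₚ.≤-trans (≤ceilDiv* a d) (ℕₚ.≤-reflexive (cong (_* suc d) N≡0)))
    (ℕₚ.<⇒≱ (ℕₚ.m<n⇒0<n∸m rk₀<n))

  N≡ : N ≡ suc (ℕ.pred N)
  N≡ = sym (ℕₚ.suc-pred N {{ℕ.>-nonZero 0<N}})

  -- Of N intervals only N - 1 are used. The r - 1 points of the last one and r k₀ others make r(k₀
  -- + 1) - 1, one fewer than r disjoint vertices occupy.
  upper : Colorable r (suc k₀) P N
  upper = subst (Colorable r (suc k₀) P) (sym N≡) (colourable d k₀ P (ℕ.pred N) (begin-strict
    n                                              ≤⟨ ℕₚ.m≤n+m∸n n (r * k₀) ⟩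
    r * k₀ ℕ.+ a                                   ≤⟨ ℕₚ.+-monoʳ-≤ (r * k₀) (≤ceilDiv* a d) ⟩
    r * k₀ ℕ.+ N * suc d                           ≡⟨ cong (λ t → r * k₀ ℕ.+ t * suc d) N≡ ⟩
    r * k₀ ℕ.+ suc (ℕ.pred N) * suc d              <⟨ ℕₚ.n<1+n _ ⟩
    suc (r * k₀ ℕ.+ (suc d ℕ.+ ℕ.pred N * suc d))  ≡⟨ rearrange (r * k₀) d (ℕ.pred N * suc d) ⟩
    ℕ.pred N * suc d ℕ.+ (r ℕ.+ r * k₀)            ≡⟨ cong (ℕ.pred N * suc d ℕ.+_) (sym (ℕₚ.*-suc r k₀)) ⟩
    ℕ.pred N * suc d ℕ.+ r * suc k₀                ∎))
    where
    open ℕₚ.≤-Reasoning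
    rearrange : ∀ x d y → suc (x ℕ.+ (suc d ℕ.+ y)) ≡ y ℕ.+ (suc (suc d) ℕ.+ x)
    rearrange = ℕ-solve-∀

  lower : ∀ m → Colorable r (suc k₀) P m → N ≤ m
  lower m colouring = decidable-stable (N ℕ.≤? m) λ N≰m →
    -- If m < N, then m(r - 1) < n - r k₀ by `ceilDiv≤`; adding r k₀ + m to both sides gives the
    -- required inequality.
    not-colourable r k₀ P (λ i → ℕₚ.≤-trans (blocks≤ i) (b≤ r)) m (begin-strict
      r * (k₀ ℕ.+ m)                       ≡⟨ expand d k₀ m ⟩
      (m * suc d ℕ.+ r * k₀) ℕ.+ m         <⟨ ℕₚ.+-monoˡ-< m (ℕₚ.m≤o∸n⇒m+n≤o (suc (m * suc d)) (ℕₚ.<⇒≤ rk₀<n)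
                                                (ℕₚ.≰⇒> (N≰m ∘ ceilDiv≤ a d m))) ⟩
      n ℕ.+ m                              ∎) colouring
    where
    open ℕₚ.≤-Reasoning
    expand : ∀ d k m → suc (suc d) * (k ℕ.+ m) ≡ (m * suc d ℕ.+ suc (suc d) * k) ℕ.+ m
    expand = ℕ-solve-∀
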